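{- Let $k\ge3$. For $n\ge0$ let $ud(n)$ and $uu(n)$ be the numbers of up-down, respectively up-up, permutations of length $n$ that contain $1\mbox{ - }3\mbox{ - }2$ exactly once and avoid $2\mbox{ - }1\mbox{ - }3\mbox{ - }\cdots\mbox{ - }k$. Writing $U_r$ for $U_r\!\left(\frac1{2x}\right)$, (1) $\displaystyle\sum_{n\ge0}ud(n)x^n=\frac{1}{U_{k-1}^2}\left(\sum_{j=0}^{k-3}U_{j+1}U_j-x\right)$; (2) $\displaystyle\sum_{n\ge0}uu(n)x^n=\frac{1}{xU_{k-1}^2}\left(xU_{k-4}U_{k-2}+\sum_{j=0}^{k-4}U_jU_{j+1}\right)$.
   Context: A permutation of length $n$ is a word $\pi_1\cdots\pi_n$ containing each of $1,\dots,n$ exactly once. A classical pattern $\tau$ of length $m$ (written with dashes) occurs in $\pi$ at indices $i_1<\dots<i_m$ if $\pi_{i_1}\cdots\pi_{i_m}$ is order-isomorphic to $\tau$; containing $\tau$ exactly once means there is exactly one such tuple, avoiding means there is none. $1\mbox{ - }3\mbox{ - }2$ is the pattern $132$ and $2\mbox{ - }1\mbox{ - }3\mbox{ - }\cdots\mbox{ - }k$ is the permutation $2\,1\,3\,4\cdots k$. For $n\ge2$: up-down permutations satisfy $\pi_1<\pi_2>\pi_3<\cdots$ with $n$ odd; up-up ones satisfy $\pi_1<\pi_2>\pi_3<\cdots$ with $n$ even; for $n=0,1$ there are none. $U_r$ is the Chebyshev polynomial of the second kind, $U_r(\cos\theta)=\sin((r+1)\theta)/\sin\theta$; $U_{ -1}=0$,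 $U_0=1$, $U_1(t)=2t$, $U_r(t)=2tU_{r-1}(t)-U_{r-2}(t)$. -}

module Defs where

open import Data.Nat as ℕ using (ℕ; zero; suc; _<ᵇ_; _≡ᵇ_; _∸_)
open import Data.Integer as ℤ using (ℤ; +_)
open import Data.Bool using (Bool; true; false; _∧_; not; if_then_else_)
open import Data.List using (List; []; _∷_; map; _++_; length; concatMap; upTo; zip)
open import Data.Product using (_×_; _,_; proj₁; proj₂)

-- Permutations of length n: all words containing 1..n exactly once,
-- generated by inserting n into every position of every permutation of
-- length n-1 (each permutation appears exactly once).

insertAll : ℕ → List ℕ → List (List ℕ)
insertAll x [] = (x ∷ []) ∷ []
insertAll x (y ∷ ys) = (x ∷ y ∷ ys) ∷ map (y ∷_) (insertAll x ys)

perms : ℕ → List (List ℕ)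
perms zero = [] ∷ []
perms (suc n) = concatMap (insertAll (suc n)) (perms n)

subs : {A : Set} → ℕ → List A → List (List A)
subs zero _ = [] ∷ []
subs (suc m) [] = []
subs (suc m) (x ∷ xs) = map (x ∷_) (subs m xs) ++ subs (suc m) xs

allB : {A : Set} → (A → Bool) → List A → Bool
allB P [] = true
allB P (x ∷ xs) = P x ∧ allB P xs

eqB : Bool → Bool → Bool
eqB true b = b
eqB false b = not b

orderIso : List ℕ → List ℕ → Bool
orderIso a b = (length a ≡ᵇ length b) ∧
  allB (λ p → allB (λ q → eqB (proj₁ p <ᵇ proj₁ q) (proj₂ p <ᵇ proj₂ q)) ps) ps
  where ps = zip a b

countB : {A : Set} → (A → Bool) → List A → ℕ
countB P [] = 0
countB P (x ∷ xs) = if P x then suc (countB P xs) else countB P xs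

occ : List ℕ → List ℕ → ℕ
occ τ π = countB (orderIso τ) (subs (length τ) π)

pat132 : List ℕ
pat132 = 1 ∷ 3 ∷ 2 ∷ []

pat213k : ℕ → List ℕ
pat213k k = 2 ∷ 1 ∷ map (λ i → i ℕ.+ 3) (upTo (k ∸ 2))

upFrom : Bool → List ℕ → Bool
upFrom b (x ∷ y ∷ rest) = (if b then x <ᵇ y else y <ᵇ x) ∧ upFrom (not b) (y ∷ rest)
upFrom b _ = true

isOdd : ℕ → Bool
isOdd zero = false
isOdd (suc n) = not (isOdd n)

isUpDown : List ℕ → Bool
isUpDown π = (1 <ᵇ length π) ∧ isOdd (length π) ∧ upFrom true π

isUpUp : List ℕ → Bool
isUpUp π = (1 <ᵇ length π) ∧ not (isOdd (length π)) ∧ upFrom true π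

good : ℕ → List ℕ → Bool
good k π = (occ pat132 π ≡ᵇ 1) ∧ (occ (pat213k k) π ≡ᵇ 0)

ud : ℕ → ℕ → ℕ
ud k n = countB (λ π → isUpDown π ∧ good k π) (perms n)

uu : ℕ → ℕ → ℕ
uu k n = countB (λ π → isUpUp π ∧ good k π) (perms n)

PS : Set
PS = ℕ → ℤ

_⊕_ : PS → PS → PS
(f ⊕ g) n = f n ℤ.+ g n

_⊖_ : PS → PS → PS
(f ⊖ g) n = f n ℤ.- g n

sumTo : ℕ → (ℕ → ℤ) → ℤ
sumTo zero f = + 0
sumTo (suc m) f = sumTo m f ℤ.+ f m

_⊛_ : PS → PS → PS
(f ⊛ g) n = sumTo (suc n) (λ i → f i ℤ.* g (n ∸ i))

infixl 7 _⊛_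
infixl 6 _⊕_ _⊖_

zeroPS : PS
zeroPS _ = + 0

xpow : ℕ → PS
xpow m n = if n ≡ᵇ m then + 1 else + 0

sumPS : ℕ → (ℕ → PS) → PS
sumPS zero f = zeroPS
sumPS (suc m) f = sumPS m f ⊕ f m

UD : ℕ → PS
UD k n = + ud k n

UU : ℕ → PS
UU k n = + uu k n

-- Scaled Chebyshev polynomials:  W (r+1) = x^r · U_r(1/(2x)),  W 0 = U_{-1} = 0.
-- From U_r(t) = 2t U_{r-1}(t) - U_{r-2}(t) with t = 1/(2x):
--   x^r U_r = x^{r-1} U_{r-1} - x^2 · x^{r-2} U_{r-2}.

W : ℕ → PS
W zero = zeroPS
W (suc zero) = xpow 0
W (suc (suc m)) = W (suc m) ⊖ xpow 2 ⊛ W m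

{-# OPTIONS --safe #-}
module Submission where

-- A permutation with at most one occurrence of 1-3-2 is cut at its maximum N.
-- Either it is α N β with every letter of α above every letter of β, or it is
-- α m N β where exactly one letter b of β exceeds m and α lies above β; in the
-- second case m N b is the only occurrence of 1-3-2 that is not inside α or β.
-- Under this cut α loses one letter of the pattern 2-1-3-⋯-k, since N can play
-- the role of k, while β avoids the same pattern.  With O, E the series of the
-- odd and even 1-3-2-avoiders and D the series of the words counted by ud or uu,
-- this gives, for k ≥ 4 and the parity of D also taken on the right,
--   O_k = x + x O_{k-1} O_k,   E_k = 1 + x O_{k-1} E_k,
--   D_k = x (ud_{k-1} C_k + O_{k-1} D_k) + x² E_{k-1} C'_k,
-- where C_k is O_k or E_k and C'_k omits the empty word; for k = 3 the last term
-- is x³ or 0.  Hence O_k W_k = x W_{k-1}, E_k W_k = W_{k-1}, and multiplying the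
-- third equation by W_{k-1} W_k yields ud_k W_k² = x² ud_{k-1} W_{k-1}² +
-- x³ W_{k-1} W_{k-2}, which sums up to (1); (2) then follows from the identity
-- W_m² = W_{m-1} W_{m+1} + x^{2m-2}.

open import Defs
open import Level using (0ℓ)
open import Data.Nat as ℕ using (ℕ; zero; suc; _≤_; _<_; s≤s; z≤n; _∸_; _+_; _*_; _<ᵇ_; _≡ᵇ_)
import Data.Nat.Properties as ℕₚ
open import Data.Nat.Solver renaming (module +-*-Solver to ℕ-Solver)
open import Data.Integer as ℤ using (ℤ) renaming (+_ to pos)
import Data.Integer.Properties as ℤₚ
open import Data.Integer.Solver renaming (module +-*-Solver to ℤ-Solver)
open import Data.Bool using (Bool; true; false; _∧_; _∨_; not; if_then_else_; T)
open import Data.Bool.Properties using (∨-assoc; ∨-zeroʳ; ∧-zeroʳ; ∧-identityʳ; ∧-assoc; not-involutive)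
open import Data.Empty using (⊥-elim)
open import Data.Unit using (tt)
open import Data.List using (List; []; _∷_; map; _++_; length; concatMap; cartesianProductWith; zip; upTo; applyUpTo)
open import Data.List.Properties using (∷-injectiveˡ; ∷-injectiveʳ; length-map; length-++; length-upTo; ++-assoc; ++-cancelʳ; map-injective)
open import Data.List.Membership.Propositional using (_∈_; _∉_; find; lose)
open import Data.List.Membership.Propositional.Properties
open import Data.List.Relation.Unary.Any using (here; there)
open import Data.List.Relation.Unary.All as All using (All; []; _∷_)
import Data.List.Relation.Unary.All.Properties as Allₚ
open import Data.List.Relation.Unary.AllPairs as AllPairs using (AllPairs; []; _∷_)
open import Data.List.Relation.Unary.Linked using (Linked; [-]; _∷_)
open import Data.List.Relation.Unary.Linked.Properties using (Linked⇒AllPairs)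
open import Data.List.Relation.Unary.Unique.Propositional using (Unique)
import Data.List.Relation.Unary.Unique.Propositional.Properties as Uniqueₚ
open import Data.List.Relation.Binary.Disjoint.Propositional using (Disjoint)
open import Data.List.Relation.Binary.Permutation.Propositional
open import Data.List.Relation.Binary.Permutation.Propositional.Properties as ↭ₚ using (All-resp-↭; ∈-resp-↭; ↭-map-inv; ↭-length; ↭-empty-inv; shift; drop-mid)
open import Data.Product using (∃; ∃₂; _×_; _,_; proj₁; proj₂)
open import Data.Sum using (inj₁; inj₂)
open import Algebra.Bundles using (CommutativeSemiring)
import Algebra.Solver.Ring.NaturalCoefficients.Default as SemiringSolver
import Relation.Binary.Reasoning.Setoid as SetoidReasoning
open import Relation.Binary.Definitions using (tri<; tri≈; tri>)
open import Relation.Binary.PropositionalEquality as ≡ using (_≡_; _≢_; cong; cong₂; subst)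
open import Relation.Nullary using (yes; no)

-- Formal power series

-- The maximum N is a peak, so the word before it has odd length in the first case; in the second, m
-- is a valley and the word before m has even length. In both, β keeps the parity of the whole. The
-- word N alone escapes this rule and supplies the summand x of O_k. The second case changes at k =
-- 3. There x m N is a 2-1-3 for every letter x before m, and a β of two or more letters that starts
-- with an ascent puts a letter smaller than m between m and b. Only the word 1 3 2 survives, whence
-- x³ or 0. The induction itself is anchored one step lower, at k = 2, where O = x and D = 0. The x
-- subtracted in (1) also comes from k = 3, where W_3 = W_2 - x² takes the place of W_2. In (2) the
-- power of x left over by the identity for W_m² is exactly what completes the odd series of index k
-- - 1 to its sum. Multiplying (1) and (2) by x^(2k-2) turns U_{k-1}² into W_k² and U_{j+1}U_j into
-- x^(2k-3-2j) W_{j+2}W_{j+1}; the factor x^5 in (2) arises in the same way.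

infix 4 _≐_
_≐_ : PS → PS → Set
f ≐ g = ∀ n → f n ≡ g n

tail : PS → PS
tail f n = f (suc n)

sumTo-cong : ∀ m {f g : ℕ → ℤ} → (∀ i → i < m → f i ≡ g i) → sumTo m f ≡ sumTo m g
sumTo-cong zero    h = ≡.refl
sumTo-cong (suc m) h = cong₂ ℤ._+_ (sumTo-cong m (λ i i<m → h i (ℕₚ.m≤n⇒m≤1+n i<m))) (h m ℕₚ.≤-refl)

sumTo-front : ∀ m (f : ℕ → ℤ) → sumTo (suc m) f ≡ f 0 ℤ.+ sumTo m (λ i → f (suc i))
sumTo-front zero    f = ℤₚ.+-comm (pos 0) (f 0)
sumTo-front (suc m) f = begin
  sumTo (suc m) f ℤ.+ f (suc m)                          ≡⟨ cong (ℤ._+ f (suc m)) (sumTo-front m f) ⟩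
  f 0 ℤ.+ sumTo m (λ i → f (suc i)) ℤ.+ f (suc m)        ≡⟨ ℤₚ.+-assoc (f 0) _ _ ⟩
  f 0 ℤ.+ (sumTo m (λ i → f (suc i)) ℤ.+ f (suc m))      ∎
  where open ≡.≡-Reasoning

⊛-suc : ∀ f g n → (f ⊛ g) (suc n) ≡ f 0 ℤ.* g (suc n) ℤ.+ (tail f ⊛ g) n
⊛-suc f g n = sumTo-front (suc n) (λ i → f i ℤ.* g (suc n ∸ i))

⊛-zero : ∀ f g → (f ⊛ g) 0 ≡ f 0 ℤ.* g 0
⊛-zero f g = ℤₚ.+-identityˡ _

-- Peeling off the last summand instead of the first mirrors `⊛-suc`; the two recursions together
-- give commutativity by induction on the coefficient.
⊛-sucʳ : ∀ f g n → (f ⊛ g) (suc n) ≡ (f ⊛ tail g) n ℤ.+ f (suc n) ℤ.* g 0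
⊛-sucʳ f g n = cong₂ ℤ._+_
  (sumTo-cong (suc n) λ { i (s≤s i≤n) → cong (λ j → f i ℤ.* g j) (ℕₚ.+-∸-assoc 1 i≤n) })
  (cong (λ j → f (suc n) ℤ.* g j) (ℕₚ.n∸n≡0 n))

⊛-cong : ∀ {f f' g g'} → f ≐ f' → g ≐ g' → f ⊛ g ≐ f' ⊛ g'
⊛-cong p q n = sumTo-cong (suc n) (λ i _ → cong₂ ℤ._*_ (p i) (q (n ∸ i)))

⊛-comm : ∀ f g → f ⊛ g ≐ g ⊛ f
⊛-comm f g zero = cong (λ t → pos 0 ℤ.+ t) (ℤₚ.*-comm (f 0) (g 0))
⊛-comm f g (suc n) = begin
  (f ⊛ g) (suc n)                             ≡⟨ ⊛-suc f g n ⟩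
  f 0 ℤ.* g (suc n) ℤ.+ (tail f ⊛ g) n        ≡⟨ cong₂ ℤ._+_ (ℤₚ.*-comm (f 0) _) (⊛-comm (tail f) g n) ⟩
  g (suc n) ℤ.* f 0 ℤ.+ (g ⊛ tail f) n        ≡⟨ ℤₚ.+-comm (g (suc n) ℤ.* f 0) _ ⟩
  (g ⊛ tail f) n ℤ.+ g (suc n) ℤ.* f 0        ≡⟨ ⊛-sucʳ g f n ⟨
  (g ⊛ f) (suc n)                             ∎
  where open ≡.≡-Reasoning

sumTo-+ : ∀ m (f g : ℕ → ℤ) → sumTo m (λ i → f i ℤ.+ g i) ≡ sumTo m f ℤ.+ sumTo m g
sumTo-+ zero    f g = ≡.refl
sumTo-+ (suc m) f g rewrite sumTo-+ m f g =
  solve 4 (λ a b c d → (a :+ b) :+ (c :+ d) := (a :+ c) :+ (b :+ d)) ≡.refl (sumTo m f) (sumTo m g) (f m) (g m)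
  where open ℤ-Solver

sumTo-*ˡ : ∀ m c (f : ℕ → ℤ) → sumTo m (λ i → c ℤ.* f i) ≡ c ℤ.* sumTo m f
sumTo-*ˡ zero    c f = ≡.sym (ℤₚ.*-zeroʳ c)
sumTo-*ˡ (suc m) c f rewrite sumTo-*ˡ m c f = ≡.sym (ℤₚ.*-distribˡ-+ c (sumTo m f) (f m))

⊛-distribˡ : ∀ f g h → f ⊛ (g ⊕ h) ≐ (f ⊛ g) ⊕ (f ⊛ h)
⊛-distribˡ f g h n = ≡.trans
  (sumTo-cong (suc n) (λ i _ → ℤₚ.*-distribˡ-+ (f i) (g (n ∸ i)) (h (n ∸ i))))
  (sumTo-+ (suc n) (λ i → f i ℤ.* g (n ∸ i)) (λ i → f i ℤ.* h (n ∸ i)))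

⊛-distribʳ : ∀ f g h → (g ⊕ h) ⊛ f ≐ (g ⊛ f) ⊕ (h ⊛ f)
⊛-distribʳ f g h n = ≡.trans (⊛-comm (g ⊕ h) f n)
  (≡.trans (⊛-distribˡ f g h n) (cong₂ ℤ._+_ (⊛-comm f g n) (⊛-comm f h n)))

⊛-scale : ∀ c f g → (λ i → c ℤ.* f i) ⊛ g ≐ (λ n → c ℤ.* (f ⊛ g) n)
⊛-scale c f g n = ≡.trans (sumTo-cong (suc n) (λ i _ → ℤₚ.*-assoc c (f i) (g (n ∸ i))))
  (sumTo-*ˡ (suc n) c (λ i → f i ℤ.* g (n ∸ i)))

⊛-assoc : ∀ f g h → (f ⊛ g) ⊛ h ≐ f ⊛ (g ⊛ h)
⊛-assoc f g h zero = begin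
  ((f ⊛ g) ⊛ h) 0               ≡⟨ ⊛-zero (f ⊛ g) h ⟩
  (f ⊛ g) 0 ℤ.* h 0             ≡⟨ cong (ℤ._* h 0) (⊛-zero f g) ⟩
  f 0 ℤ.* g 0 ℤ.* h 0           ≡⟨ ℤₚ.*-assoc (f 0) (g 0) (h 0) ⟩
  f 0 ℤ.* (g 0 ℤ.* h 0)         ≡⟨ cong (f 0 ℤ.*_) (⊛-zero g h) ⟨
  f 0 ℤ.* (g ⊛ h) 0             ≡⟨ ⊛-zero f (g ⊛ h) ⟨
  (f ⊛ (g ⊛ h)) 0               ∎
  where open ≡.≡-Reasoning
⊛-assoc f g h (suc n) = begin
  ((f ⊛ g) ⊛ h) (suc n)
    ≡⟨ ⊛-suc (f ⊛ g) h n ⟩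
  (f ⊛ g) 0 ℤ.* h (suc n) ℤ.+ (tail (f ⊛ g) ⊛ h) n
    ≡⟨ cong₂ ℤ._+_ (cong (ℤ._* h (suc n)) (⊛-zero f g)) (⊛-cong {g = h} (⊛-suc f g) (λ _ → ≡.refl) n) ⟩
  f 0 ℤ.* g 0 ℤ.* h (suc n) ℤ.+ (((λ i → f 0 ℤ.* tail g i) ⊕ (tail f ⊛ g)) ⊛ h) n
    ≡⟨ cong (λ t → f 0 ℤ.* g 0 ℤ.* h (suc n) ℤ.+ t) (⊛-distribʳ h (λ i → f 0 ℤ.* tail g i) (tail f ⊛ g) n) ⟩
  f 0 ℤ.* g 0 ℤ.* h (suc n) ℤ.+ (((λ i → f 0 ℤ.* tail g i) ⊛ h) n ℤ.+ ((tail f ⊛ g) ⊛ h) n)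
    ≡⟨ cong (λ t → f 0 ℤ.* g 0 ℤ.* h (suc n) ℤ.+ t) (cong₂ ℤ._+_ (⊛-scale (f 0) (tail g) h n) (⊛-assoc (tail f) g h n)) ⟩
  f 0 ℤ.* g 0 ℤ.* h (suc n) ℤ.+ (f 0 ℤ.* (tail g ⊛ h) n ℤ.+ (tail f ⊛ (g ⊛ h)) n)
    ≡⟨ solve 5 (λ a b c d e → a :* b :* c :+ (a :* d :+ e) := a :* (b :* c :+ d) :+ e) ≡.refl
         (f 0) (g 0) (h (suc n)) ((tail g ⊛ h) n) ((tail f ⊛ (g ⊛ h)) n) ⟩
  f 0 ℤ.* (g 0 ℤ.* h (suc n) ℤ.+ (tail g ⊛ h) n) ℤ.+ (tail f ⊛ (g ⊛ h)) n
    ≡⟨ cong (λ t → f 0 ℤ.* t ℤ.+ (tail f ⊛ (g ⊛ h)) n) (⊛-suc g h n) ⟨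
  f 0 ℤ.* (g ⊛ h) (suc n) ℤ.+ (tail f ⊛ (g ⊛ h)) n
    ≡⟨ ⊛-suc f (g ⊛ h) n ⟨
  (f ⊛ (g ⊛ h)) (suc n) ∎
  where
  open ≡.≡-Reasoning
  open ℤ-Solver

⊛-zeroˡ : ∀ f → zeroPS ⊛ f ≐ zeroPS
⊛-zeroˡ f n = sumTo-*ˡ (suc n) (pos 0) (λ i → f (n ∸ i))

xpow-suc-⊛-zero : ∀ m f → (xpow (suc m) ⊛ f) 0 ≡ pos 0
xpow-suc-⊛-zero m f = ⊛-zero (xpow (suc m)) f

xpow-suc-⊛-suc : ∀ m f n → (xpow (suc m) ⊛ f) (suc n) ≡ (xpow m ⊛ f) n
xpow-suc-⊛-suc m f n = ≡.trans (⊛-suc (xpow (suc m)) f n) (ℤₚ.+-identityˡ _)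

⊛-identityˡ : ∀ f → xpow 0 ⊛ f ≐ f
⊛-identityˡ f zero = ≡.trans (⊛-zero (xpow 0) f) (ℤₚ.*-identityˡ _)
⊛-identityˡ f (suc n) = ≡.trans (⊛-suc (xpow 0) f n)
  (≡.trans (cong₂ ℤ._+_ (ℤₚ.*-identityˡ (f (suc n))) (⊛-zeroˡ f n)) (ℤₚ.+-identityʳ _))

xpow-+ : ∀ m n → xpow m ⊛ xpow n ≐ xpow (m ℕ.+ n)
xpow-+ zero    n i       = ⊛-identityˡ (xpow n) i
xpow-+ (suc m) n zero    = xpow-suc-⊛-zero m (xpow n)
xpow-+ (suc m) n (suc i) = ≡.trans (xpow-suc-⊛-suc m (xpow n) i) (xpow-+ m n i)

-- A semiring suffices for the identities to come: negative terms are moved across the equation, and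
-- `PS-cancel` supplies additive cancellation.
PS-commutativeSemiring : CommutativeSemiring 0ℓ 0ℓ
PS-commutativeSemiring = record
  { Carrier = PS ; _≈_ = _≐_ ; _+_ = _⊕_ ; _*_ = _⊛_ ; 0# = zeroPS ; 1# = xpow 0
  ; isCommutativeSemiring = record
    { isSemiring = record
      { isSemiringWithoutAnnihilatingZero = record
        { +-isCommutativeMonoid = record
          { isMonoid = record
            { isSemigroup = record
              { isMagma = record
                { isEquivalence = record
                  { refl = λ _ → ≡.refl ; sym = λ p n → ≡.sym (p n) ; trans = λ p q n → ≡.trans (p n) (q n) }
                ; ∙-cong = λ p q n → cong₂ ℤ._+_ (p n) (q n) }
              ; assoc = λ f g h n → ℤₚ.+-assoc (f n) (g n) (h n) }
            ; identity = (λ f n → ℤₚ.+-identityˡ (f n)) , (λ f n → ℤₚ.+-identityʳ (f n)) }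
          ; comm = λ f g n → ℤₚ.+-comm (f n) (g n) }
        ; *-cong = ⊛-cong
        ; *-assoc = ⊛-assoc
        ; *-identity = ⊛-identityˡ , (λ f n → ≡.trans (⊛-comm f (xpow 0) n) (⊛-identityˡ f n))
        ; distrib = ⊛-distribˡ , ⊛-distribʳ }
      ; zero = ⊛-zeroˡ , (λ f n → ≡.trans (⊛-comm f zeroPS n) (⊛-zeroˡ f n)) }
    ; *-comm = ⊛-comm } }

-- Permutations and counting

private variable
  A B C : Set

-- Descending, so that the maximum is the head and deleting it from a permutation of `iota (suc n)`
-- leaves one of `iota n`.
iota : ℕ → List ℕ
iota zero    = []
iota (suc n) = suc n ∷ iota n

iota-≤ : ∀ n → All (_≤ n) (iota n)
iota-≤ zero    = []
iota-≤ (suc n) = ℕₚ.≤-refl ∷ All.map ℕₚ.m≤n⇒m≤1+n (iota-≤ n)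

iota-unique : ∀ n → Unique (iota n)
iota-unique zero    = []
iota-unique (suc n) = All.map (λ { le ≡.refl → ℕₚ.1+n≰n le }) (iota-≤ n) ∷ iota-unique n

length-iota : ∀ n → length (iota n) ≡ n
length-iota zero    = ≡.refl
length-iota (suc n) = cong suc (length-iota n)

Unique-resp : {xs ys : List A} → xs ↭ ys → Unique xs → Unique ys
Unique-resp refl         u = u
Unique-resp (prep x p)   (x∉ ∷ u) = All-resp-↭ p x∉ ∷ Unique-resp p u
Unique-resp (swap x y p) ((x≢y ∷ x∉) ∷ y∉ ∷ u) =
  ((λ e → x≢y (≡.sym e)) ∷ All-resp-↭ p y∉) ∷ All-resp-↭ p x∉ ∷ Unique-resp p u
Unique-resp (trans p q)  u = Unique-resp q (Unique-resp p u)

insertAll-∈⁻ : ∀ {x v} ys → v ∈ insertAll x ys → ∃₂ λ l r → v ≡ l ++ x ∷ r × ys ≡ l ++ r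
insertAll-∈⁻ []       (here e)  = [] , [] , e , ≡.refl
insertAll-∈⁻ (y ∷ ys) (here e)  = [] , y ∷ ys , e , ≡.refl
insertAll-∈⁻ (y ∷ ys) (there p)
  with w , w∈ , ≡.refl ← ∈-map⁻ (y ∷_) p
  with l , r , ≡.refl , ≡.refl ← insertAll-∈⁻ ys w∈ = y ∷ l , r , ≡.refl , ≡.refl

insertAll-∈⁺ : ∀ x l r → l ++ x ∷ r ∈ insertAll x (l ++ r)
insertAll-∈⁺ x []      []      = here ≡.refl
insertAll-∈⁺ x []      (y ∷ r) = here ≡.refl
insertAll-∈⁺ x (y ∷ l) r       = there (∈-map⁺ (y ∷_) (insertAll-∈⁺ x l r))

-- With the converse below, this trades the insertion procedure of `perms` for the relation `↭`, in
-- which words can be cut and relabelled freely.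
∈-perms⇒↭ : ∀ n {v} → v ∈ perms n → v ↭ iota n
∈-perms⇒↭ zero    (here ≡.refl) = refl
∈-perms⇒↭ (suc n) p
  with w , w∈ , v∈ ← find (∈-concatMap⁻ (insertAll (suc n)) {xs = perms n} p)
  with l , r , ≡.refl , ≡.refl ← insertAll-∈⁻ w v∈
  = trans (shift (suc n) l r) (prep _ (∈-perms⇒↭ n w∈))

↭⇒∈-perms : ∀ n {v} → v ↭ iota n → v ∈ perms n
↭⇒∈-perms zero    p rewrite ↭-empty-inv p = here ≡.refl
↭⇒∈-perms (suc n) p
  with l , r , ≡.refl ← ∈-∃++ (∈-resp-↭ (↭-sym p) (here ≡.refl))
  = ∈-concatMap⁺ (insertAll (suc n))
      (lose (↭⇒∈-perms n (drop-mid l [] p)) (insertAll-∈⁺ (suc n) l r))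

split-unique : ∀ {x : A} l l' {r r'} → x ∉ l → x ∉ l' → l ++ x ∷ r ≡ l' ++ x ∷ r' → l ≡ l' × r ≡ r'
split-unique []      []       _ _  e = ≡.refl , ∷-injectiveʳ e
split-unique []      (y ∷ l') _ x∉ e = ⊥-elim (x∉ (here (∷-injectiveˡ e)))
split-unique (y ∷ l) []       x∉ _ e = ⊥-elim (x∉ (here (≡.sym (∷-injectiveˡ e))))
split-unique (y ∷ l) (z ∷ l') x∉ x∉' e with ≡.refl ← ∷-injectiveˡ e
  with ≡.refl , eq ← split-unique l l' (λ p → x∉ (there p)) (λ p → x∉' (there p)) (∷-injectiveʳ e) = ≡.refl , eq

insertAll-unique : ∀ x ys → x ∉ ys → Unique (insertAll x ys)
insertAll-unique x []       _  = [] ∷ []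
insertAll-unique x (y ∷ ys) x∉ =
  All.tabulate (λ p e → let _ , _ , eq = ∈-map⁻ (y ∷_) p in
    x∉ (here (∷-injectiveˡ (≡.trans e eq))))
  ∷ Uniqueₚ.map⁺ ∷-injectiveʳ (insertAll-unique x ys (λ p → x∉ (there p)))

suc-∉-perms : ∀ n {v} → v ∈ perms n → suc n ∉ v
suc-∉-perms n v∈ p = ℕₚ.1+n≰n (All.lookup (All-resp-↭ (↭-sym (∈-perms⇒↭ n v∈)) (iota-≤ n)) p)

concatMap-unique : ∀ (f : A → List B) {xs} → Unique xs → (∀ {x} → x ∈ xs → Unique (f x)) →
  (∀ {x y v} → x ∈ xs → y ∈ xs → v ∈ f x → v ∈ f y → x ≡ y) → Unique (concatMap f xs)
concatMap-unique f {[]}     _        _ _ = []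
concatMap-unique f {x ∷ xs} (x∉ ∷ u) h d = Uniqueₚ.++⁺ (h (here ≡.refl))
  (concatMap-unique f u (λ p → h (there p)) (λ p q → d (there p) (there q)))
  λ { (v∈ , v∈') → let y , y∈ , v∈y = find (∈-concatMap⁻ f {xs = xs} v∈') in
        All.lookup x∉ y∈ (d (here ≡.refl) (there y∈) v∈ v∈y) }

-- The largest letter marks its own place of insertion, so a word determines the permutation it was
-- built from.
perms-unique : ∀ n → Unique (perms n)
perms-unique zero    = [] ∷ []
perms-unique (suc n) = concatMap-unique (insertAll (suc n)) (perms-unique n)
  (λ p → insertAll-unique (suc n) _ (suc-∉-perms n p))
  λ p q v∈ v∈' → same p q (insertAll-∈⁻ _ v∈) (insertAll-∈⁻ _ v∈')
  where
  same : ∀ {x y v} → x ∈ perms n → y ∈ perms n →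
    (∃₂ λ l r → v ≡ l ++ suc n ∷ r × x ≡ l ++ r) → (∃₂ λ l r → v ≡ l ++ suc n ∷ r × y ≡ l ++ r) → x ≡ y
  same p q (l , r , ≡.refl , ≡.refl) (l' , r' , e , ≡.refl)
    with ≡.refl , ≡.refl ← split-unique l l' (λ z → suc-∉-perms n p (∈-++⁺ˡ z))
                             (λ z → suc-∉-perms n q (∈-++⁺ˡ z)) e = ≡.refl

χ : Bool → ℕ
χ b = if b then 1 else 0

countB-∷ : ∀ (P : A → Bool) x xs → countB P (x ∷ xs) ≡ χ (P x) + countB P xs
countB-∷ P x xs with P x
... | true  = ≡.refl
... | false = ≡.refl

countB-++ : ∀ (P : A → Bool) xs ys → countB P (xs ++ ys) ≡ countB P xs + countB P ys
countB-++ P []       ys = ≡.refl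
countB-++ P (x ∷ xs) ys with P x
... | true  = cong suc (countB-++ P xs ys)
... | false = countB-++ P xs ys

countB-map : ∀ (P : B → Bool) (f : A → B) xs → countB P (map f xs) ≡ countB (λ x → P (f x)) xs
countB-map P f []       = ≡.refl
countB-map P f (x ∷ xs) with P (f x)
... | true  = cong suc (countB-map P f xs)
... | false = countB-map P f xs

countB-cong : ∀ {P Q : A → Bool} xs → (∀ {x} → x ∈ xs → P x ≡ Q x) → countB P xs ≡ countB Q xs
countB-cong []       h = ≡.refl
countB-cong (x ∷ xs) h rewrite h (here ≡.refl) | countB-cong xs (λ p → h (there p)) = ≡.refl

countB-none : ∀ {P : A → Bool} xs → (∀ {x} → x ∈ xs → P x ≡ false) → countB P xs ≡ 0
countB-none []       h = ≡.refl
countB-none (x ∷ xs) h rewrite h (here ≡.refl) = countB-none xs (λ p → h (there p))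

countB-↭ : ∀ (P : A → Bool) {xs ys} → xs ↭ ys → countB P xs ≡ countB P ys
countB-↭ P refl        = ≡.refl
countB-↭ P (prep x p) rewrite countB-↭ P p = ≡.refl
countB-↭ P (swap x y p) rewrite countB-↭ P p with P x | P y
... | true  | true  = ≡.refl
... | true  | false = ≡.refl
... | false | true  = ≡.refl
... | false | false = ≡.refl
countB-↭ P (trans p q) = ≡.trans (countB-↭ P p) (countB-↭ P q)

-- Each counted `x` is deleted from `ys` before the next one is matched; uniqueness of `xs` keeps
-- the later elements inside what remains.
countB-mono : ∀ (P : A → Bool) xs ys → Unique xs →
  (∀ {v} → P v ≡ true → v ∈ xs → v ∈ ys) → countB P xs ≤ countB P ys
countB-mono P []       ys u h = z≤n
countB-mono P (x ∷ xs) ys (x∉ ∷ u) h with P x in eq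
... | false = countB-mono P xs ys u (λ Pv v∈ → h Pv (there v∈))
... | true with l , r , ≡.refl ← ∈-∃++ (h eq (here ≡.refl)) = begin
    suc (countB P xs)              ≤⟨ s≤s (countB-mono P xs (l ++ r) u sub) ⟩
    suc (countB P (l ++ r))        ≡⟨ cong (λ b → χ b + countB P (l ++ r)) eq ⟨
    χ (P x) + countB P (l ++ r)    ≡⟨ countB-∷ P x (l ++ r) ⟨
    countB P (x ∷ l ++ r)          ≡⟨ countB-↭ P (shift x l r) ⟨
    countB P (l ++ x ∷ r)          ∎
  where
  open ℕₚ.≤-Reasoning
  sub : ∀ {v} → P v ≡ true → v ∈ xs → v ∈ l ++ r
  sub Pv v∈ with ∈-resp-↭ (shift x l r) (h Pv (there v∈))
  ... | here ≡.refl = ⊥-elim (All.lookup x∉ v∈ ≡.refl)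
  ... | there p     = p

-- The inclusions are asked only of elements that `P` accepts: a permutation with two or more
-- occurrences of 1-3-2 need not be a glued word.
countB-same : ∀ (P : A → Bool) xs ys → Unique xs → Unique ys →
  (∀ {v} → P v ≡ true → v ∈ xs → v ∈ ys) → (∀ {v} → P v ≡ true → v ∈ ys → v ∈ xs) →
  countB P xs ≡ countB P ys
countB-same P xs ys u u' h h' = ℕₚ.≤-antisym (countB-mono P xs ys u h) (countB-mono P ys xs u' h')

concatTo : ℕ → (ℕ → List A) → List A
concatTo zero    f = []
concatTo (suc m) f = concatTo m f ++ f m

∈-concatTo⁻ : ∀ m {f : ℕ → List A} {v} → v ∈ concatTo m f → ∃ λ i → i < m × v ∈ f i
∈-concatTo⁻ (suc m) {f} p with ∈-++⁻ (concatTo m f) p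
... | inj₁ q = let i , i<m , v∈ = ∈-concatTo⁻ m q in i , ℕₚ.m≤n⇒m≤1+n i<m , v∈
... | inj₂ q = m , ℕₚ.≤-refl , q

∈-concatTo⁺ : ∀ m {f : ℕ → List A} {v i} → i < m → v ∈ f i → v ∈ concatTo m f
∈-concatTo⁺ (suc m) {f} {i = i} (s≤s i≤m) v∈ with ℕₚ.m≤n⇒m<n∨m≡n i≤m
... | inj₁ i<m    = ∈-++⁺ˡ (∈-concatTo⁺ m i<m v∈)
... | inj₂ ≡.refl = ∈-++⁺ʳ (concatTo m f) v∈

concatTo-unique : ∀ m (f : ℕ → List A) → (∀ i → i < m → Unique (f i)) →
  (∀ {i j v} → i < m → j < m → v ∈ f i → v ∈ f j → i ≡ j) → Unique (concatTo m f)
concatTo-unique zero    f h d = []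
concatTo-unique (suc m) f h d = Uniqueₚ.++⁺
  (concatTo-unique m f (λ i i<m → h i (ℕₚ.m≤n⇒m≤1+n i<m)) (λ p q → d (ℕₚ.m≤n⇒m≤1+n p) (ℕₚ.m≤n⇒m≤1+n q)))
  (h m ℕₚ.≤-refl)
  λ { (v∈ , v∈') → let i , i<m , v∈i = ∈-concatTo⁻ m v∈ in
        ℕₚ.<-irrefl (d (ℕₚ.m≤n⇒m≤1+n i<m) ℕₚ.≤-refl v∈i v∈') i<m }

cartesianProductWith-unique : ∀ (f : A → B → C) {xs ys} → Unique xs → Unique ys →
  (∀ {x y x' y'} → x ∈ xs → y ∈ ys → x' ∈ xs → y' ∈ ys → f x y ≡ f x' y' → x ≡ x' × y ≡ y') →
  Unique (cartesianProductWith f xs ys)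
cartesianProductWith-unique f {[]}     {ys} _        _  _   = []
cartesianProductWith-unique f {x ∷ xs} {ys} (x∉ ∷ u) u' inj = Uniqueₚ.++⁺
  (map-unique u' (λ p q e → proj₂ (inj (here ≡.refl) p (here ≡.refl) q e)))
  (cartesianProductWith-unique f u u' (λ p q p' q' → inj (there p) q (there p') q'))
  disjoint
  where
  map-unique : ∀ {zs} → Unique zs → (∀ {y y'} → y ∈ zs → y' ∈ zs → f x y ≡ f x y' → y ≡ y') →
    Unique (map (f x) zs)
  map-unique []       _ = []
  map-unique (z∉ ∷ v) h = Allₚ.map⁺ (All.tabulate λ p e → All.lookup z∉ p (h (here ≡.refl) (there p) e))
    ∷ map-unique v (λ p q → h (there p) (there q))
  disjoint : Disjoint (map (f x) ys) (cartesianProductWith f xs ys)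
  disjoint (p , q) with y , y∈ , ≡.refl ← ∈-map⁻ (f x) p
    with x' , y' , x'∈ , y'∈ , e ← ∈-cartesianProductWith⁻ f xs ys q
    = All.lookup x∉ x'∈ (proj₁ (inj (here ≡.refl) y∈ (there x'∈) y'∈ e))

module _ {P : C → Bool} (f : A → B → C) (Q Q' : A → Bool) (R R' : B → Bool) where

  private
    row : ∀ x ys → (∀ {y} → y ∈ ys → χ (P (f x y)) ≡ χ (Q x) * χ (R y) + χ (Q' x) * χ (R' y)) →
      countB P (map (f x) ys) ≡ χ (Q x) * countB R ys + χ (Q' x) * countB R' ys
    row x []       h rewrite ℕₚ.*-zeroʳ (χ (Q x)) | ℕₚ.*-zeroʳ (χ (Q' x)) = ≡.refl
    row x (y ∷ ys) h rewrite countB-∷ P (f x y) (map (f x) ys) | countB-∷ R y ys | countB-∷ R' y ys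
      | h (here ≡.refl) | row x ys (λ p → h (there p)) =
      solve 6 (λ a b c d e g → a :* b :+ c :* d :+ (a :* e :+ c :* g) := a :* (b :+ e) :+ c :* (d :+ g)) ≡.refl
        (χ (Q x)) (χ (R y)) (χ (Q' x)) (χ (R' y)) (countB R ys) (countB R' ys)
      where
      open ℕ-Solver

  -- Two products are needed because the one occurrence of 1-3-2 in a glued word may sit in either
  -- factor. Where one product is enough, `never` fills the second place.
  countB-cartesian : ∀ xs ys →
    (∀ {x y} → x ∈ xs → y ∈ ys → χ (P (f x y)) ≡ χ (Q x) * χ (R y) + χ (Q' x) * χ (R' y)) →
    countB P (cartesianProductWith f xs ys) ≡ countB Q xs * countB R ys + countB Q' xs * countB R' ys
  countB-cartesian []       ys h = ≡.refl
  countB-cartesian (x ∷ xs) ys h rewrite countB-++ P (map (f x) ys) (cartesianProductWith f xs ys)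
    | countB-∷ Q x xs | countB-∷ Q' x xs
    | row x ys (h (here ≡.refl)) | countB-cartesian xs ys (λ p → h (there p)) =
    solve 6 (λ a b c d e g → a :* b :+ c :* d :+ (e :* b :+ g :* d) := (a :+ e) :* b :+ (c :+ g) :* d) ≡.refl
      (χ (Q x)) (countB R ys) (χ (Q' x)) (countB R' ys) (countB Q xs) (countB Q' xs)
    where
    open ℕ-Solver

-- The decomposition at the maximum

<ᵇ-true : ∀ {m n} → m < n → (m <ᵇ n) ≡ true
<ᵇ-true {m} {n} p with m <ᵇ n | ℕₚ.<⇒<ᵇ p
... | true | _ = ≡.refl

<ᵇ-false : ∀ {m n} → n ≤ m → (m <ᵇ n) ≡ false
<ᵇ-false {m} {n} p with m <ᵇ n in eq
... | false = ≡.refl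
... | true  = ⊥-elim (ℕₚ.<⇒≱ (ℕₚ.<ᵇ⇒< m n (subst T (≡.sym eq) tt)) p)

<ᵇ-true⁻ : ∀ m n → (m <ᵇ n) ≡ true → m < n
<ᵇ-true⁻ m n eq = ℕₚ.<ᵇ⇒< m n (subst T (≡.sym eq) tt)

<ᵇ-false⁻ : ∀ m n → (m <ᵇ n) ≡ false → n ≤ m
<ᵇ-false⁻ m n eq = ℕₚ.≮⇒≥ λ p → subst T eq (ℕₚ.<⇒<ᵇ p)

-- Completions of an occurrence of 1-3-2 whose 1 is x and whose 3 is y.
twos : ℕ → ℕ → List ℕ → ℕ
twos x y zs = countB (λ z → (x <ᵇ z) ∧ (z <ᵇ y)) zs

threeTwos : ℕ → List ℕ → ℕ
threeTwos x []       = 0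
threeTwos x (y ∷ ys) = twos x y ys + threeTwos x ys

occ132 : List ℕ → ℕ
occ132 []       = 0
occ132 (x ∷ xs) = threeTwos x xs + occ132 xs

orderIso-132 : ∀ x y z → orderIso pat132 (x ∷ y ∷ z ∷ []) ≡ (x <ᵇ z) ∧ (z <ᵇ y)
orderIso-132 x y z with x ℕ.<? z | z ℕ.<? y
... | no p  | _ with x≥z ← ℕₚ.≮⇒≥ p
  rewrite <ᵇ-false {x} {x} ℕₚ.≤-refl | <ᵇ-false x≥z with x <ᵇ y
... | true  = ≡.refl
... | false = ≡.refl
orderIso-132 x y z | yes p | no q with z≥y ← ℕₚ.≮⇒≥ q
  rewrite <ᵇ-false {x} {x} ℕₚ.≤-refl | <ᵇ-false {y} {y} ℕₚ.≤-refl | <ᵇ-false {z} {z} ℕₚ.≤-refl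
  | <ᵇ-true p | <ᵇ-false z≥y | <ᵇ-false (ℕₚ.<⇒≤ p) with x <ᵇ y | y <ᵇ x | y <ᵇ z
... | false | _ | _ = ≡.refl
... | true | true | _ = ≡.refl
... | true | false | true = ≡.refl
... | true | false | false = ≡.refl
orderIso-132 x y z | yes p | yes q
  rewrite <ᵇ-false {x} {x} ℕₚ.≤-refl | <ᵇ-false {y} {y} ℕₚ.≤-refl | <ᵇ-false {z} {z} ℕₚ.≤-refl
  | <ᵇ-true p | <ᵇ-true q | <ᵇ-false (ℕₚ.<⇒≤ p) | <ᵇ-false (ℕₚ.<⇒≤ q)
  | <ᵇ-true (ℕₚ.<-trans p q) | <ᵇ-false (ℕₚ.<⇒≤ (ℕₚ.<-trans p q)) = ≡.refl

occ-132 : ∀ π → occ pat132 π ≡ occ132 π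
occ-132 []       = ≡.refl
occ-132 (x ∷ xs) = ≡.trans (countB-++ Q (map (x ∷_) (subs 2 xs)) (subs 3 xs))
  (cong₂ _+_ (≡.trans (countB-map Q (x ∷_) (subs 2 xs)) (pairs xs)) (occ-132 xs))
  where
  Q = orderIso pat132
  singles : ∀ y zs → countB (λ s → Q (x ∷ y ∷ s)) (subs 1 zs) ≡ twos x y zs
  singles y []       = ≡.refl
  singles y (z ∷ zs) rewrite orderIso-132 x y z | singles y zs = ≡.refl
  pairs : ∀ ys → countB (λ s → Q (x ∷ s)) (subs 2 ys) ≡ threeTwos x ys
  pairs []       = ≡.refl
  pairs (y ∷ ys) = ≡.trans (countB-++ (λ s → Q (x ∷ s)) (map (y ∷_) (subs 1 ys)) (subs 2 ys))
    (cong₂ _+_ (≡.trans (countB-map (λ s → Q (x ∷ s)) (y ∷_) (subs 1 ys)) (singles y ys)) (pairs ys))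

countB-≡0 : ∀ x r → countB (x <ᵇ_) r ≡ 0 → All (_≤ x) r
countB-≡0 x []      _ = []
countB-≡0 x (z ∷ r) e with x <ᵇ z in eq
... | false = <ᵇ-false⁻ x z eq ∷ countB-≡0 x r e

countB-pos : ∀ x r → 1 ≤ countB (x <ᵇ_) r → ∃ λ z → z ∈ r × x < z
countB-pos x (z ∷ r) p with x <ᵇ z in eq
... | true  = z , here ≡.refl , <ᵇ-true⁻ x z eq
... | false = let z' , z∈ , q = countB-pos x r p in z' , there z∈ , q

twos-max : ∀ x {N} r → All (_< N) r → twos x N r ≡ countB (x <ᵇ_) r
twos-max x []      []       = ≡.refl
twos-max x (z ∷ r) (p ∷ ps) rewrite <ᵇ-true p | twos-max x r ps with x <ᵇ z
... | true  = ≡.refl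
... | false = ≡.refl

twos-pos : ∀ x y {z} zs → z ∈ zs → x < z → z < y → 1 ≤ twos x y zs
twos-pos x y (z ∷ zs) (here ≡.refl) p q rewrite <ᵇ-true p | <ᵇ-true q = s≤s z≤n
twos-pos x y (z' ∷ zs) (there z∈) p q with (x <ᵇ z') ∧ (z' <ᵇ y)
... | true  = s≤s z≤n
... | false = twos-pos x y zs z∈ p q

threeTwos-mid : ∀ x N l r → twos x N r ≤ threeTwos x (l ++ N ∷ r)
threeTwos-mid x N []      r = ℕₚ.m≤m+n _ _
threeTwos-mid x N (y ∷ l) r = ℕₚ.≤-trans (threeTwos-mid x N l r) (ℕₚ.m≤n+m _ (twos x y (l ++ N ∷ r)))

Above : List ℕ → ℕ → Set
Above r x = All (_< x) r

-- In `cross` the letter `a` stands immediately before the maximum; with the maximum and the single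
-- greater letter of `r` it forms the crossing 1-3-2.
data Shape (r : List ℕ) : List ℕ → Set where
  above : ∀ {l} → All (Above r) l → Shape r l
  cross : ∀ l a → All (Above r) l → countB (a <ᵇ_) r ≡ 1 → Shape r (l ++ a ∷ [])

module _ {N : ℕ} {r : List ℕ} (r<N : All (_< N) r) where

  private
    strict : ∀ {x} → All (x ≢_) r → countB (x <ᵇ_) r ≡ 0 → Above r x
    strict {x} d e = All.zipWith (λ { (le , ne) → ℕₚ.≤∧≢⇒< le (λ q → ne (≡.sym q)) }) (countB-≡0 x r e , d)

  -- A letter x before N with a greater letter z in `r` would give the occurrence x N z.
  shape₀ : ∀ l → All (λ x → All (x ≢_) r) l → occ132 (l ++ N ∷ r) ≡ 0 → All (Above r) l
  shape₀ []      _        _ = []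
  shape₀ (x ∷ l) (d ∷ ds) e =
    strict d (ℕₚ.n≤0⇒n≡0 (ℕₚ.≤-trans (ℕₚ.≤-reflexive (≡.sym (twos-max x r r<N)))
      (ℕₚ.≤-trans (threeTwos-mid x N l r) (ℕₚ.≤-reflexive (ℕₚ.m+n≡0⇒m≡0 _ e)))))
    ∷ shape₀ l ds (ℕₚ.m+n≡0⇒n≡0 (threeTwos x (l ++ N ∷ r)) e)

  -- The first x with a greater letter in `r` uses up the permitted occurrence through N. What
  -- follows x is then free of 1-3-2, and `shape₀` applies to it.
  shape : ∀ l → All (λ x → All (x ≢_) r) l → occ132 (l ++ N ∷ r) ≤ 1 → Shape r l
  shape []      _        _  = above []
  shape (x ∷ l) (d ∷ ds) le with countB (x <ᵇ_) r in eq
  shape (x ∷ l) (d ∷ ds) le | zero with shape l ds (ℕₚ.≤-trans (ℕₚ.m≤n+m _ (threeTwos x (l ++ N ∷ r))) le)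
  ... | above p       = above (strict d eq ∷ p)
  ... | cross l' a p q = cross (x ∷ l') a (strict d eq ∷ p) q
  shape (x ∷ l) (d ∷ ds) le | suc g = last l c2≥ le (shape₀ l ds rest≡0)
    where
    c2≥ : suc g ≤ twos x N r
    c2≥ = ℕₚ.≤-reflexive (≡.trans (≡.sym eq) (≡.sym (twos-max x r r<N)))
    rest≡0 : occ132 (l ++ N ∷ r) ≡ 0
    rest≡0 = ℕₚ.n≤0⇒n≡0 (ℕₚ.+-cancelˡ-≤ 1 _ _ (ℕₚ.≤-trans
      (ℕₚ.+-monoˡ-≤ _ (ℕₚ.≤-trans (s≤s z≤n) (ℕₚ.≤-trans c2≥ (threeTwos-mid x N l r)))) le))
    last : ∀ l → suc g ≤ twos x N r → occ132 (x ∷ l ++ N ∷ r) ≤ 1 → All (Above r) l → Shape r (x ∷ l)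
    last [] c le _ = cross [] x [] (ℕₚ.≤-antisym
      (ℕₚ.≤-trans (ℕₚ.≤-reflexive (≡.sym (twos-max x r r<N)))
        (ℕₚ.≤-trans (ℕₚ.m≤m+n _ (threeTwos x r)) (ℕₚ.≤-trans (ℕₚ.m≤m+n _ (occ132 (N ∷ r))) le)))
      (ℕₚ.≤-trans (s≤s z≤n) (ℕₚ.≤-reflexive (≡.sym eq))))
    -- A letter y between x and N lies above z, so x y z and x N z would be two occurrences.
    last (y ∷ l) c le (py ∷ _)
      with z , z∈ , x<z ← countB-pos x r (ℕₚ.≤-trans (s≤s z≤n) (ℕₚ.≤-reflexive (≡.sym eq)))
      = ⊥-elim (ℕₚ.<⇒≱ (ℕₚ.+-mono-≤ (twos-pos x y (l ++ N ∷ r) (∈-++⁺ʳ l (there z∈)) x<z (All.lookup py z∈))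
          (ℕₚ.≤-trans (s≤s z≤n) (ℕₚ.≤-trans c (threeTwos-mid x N l r))))
          (ℕₚ.≤-trans (ℕₚ.m≤m+n _ (occ132 (y ∷ l ++ N ∷ r))) le))

-- The increasing map onto the complement of m.
punch : ℕ → ℕ → ℕ
punch m v = if v <ᵇ m then v else suc v

-- The two ways of cutting at the maximum.  In glueB the letter before the maximum
-- is |β|, and punch lifts the largest letter of β just above it.
glueA : List ℕ → List ℕ → List ℕ
glueA α β = map (length β +_) α ++ suc (length α + length β) ∷ β

glueB : List ℕ → List ℕ → List ℕ
glueB α β = map (suc (length β) +_) α ++ length β ∷ suc (suc (length α + length β)) ∷ map (punch (length β)) β

punch-< : ∀ {m v} → v < m → punch m v ≡ v
punch-< p rewrite <ᵇ-true p = ≡.refl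

punch-≥ : ∀ {m v} → m ≤ v → punch m v ≡ suc v
punch-≥ p rewrite <ᵇ-false p = ≡.refl

↭-iota-≤ : ∀ {n v} → v ↭ iota n → All (_≤ n) v
↭-iota-≤ {n} p = All-resp-↭ (↭-sym p) (iota-≤ n)

↭-iota-length : ∀ {n v} → v ↭ iota n → length v ≡ n
↭-iota-length {n} p = ≡.trans (↭-length p) (length-iota n)

↭-iota-unique : ∀ {n v} → v ↭ iota n → Unique v
↭-iota-unique {n} p = Unique-resp (↭-sym p) (iota-unique n)

-- As long as `l` is nonempty the greatest letter lies in it; delete that letter and repeat. The
-- length `i` is carried separately because `l₁ ++ l₂` is not a structural part of `l`.
above-split : ∀ i l r n → length l ≡ i → l ++ r ↭ iota n → All (Above r) l →
  r ↭ iota (length r) × l ↭ map (length r +_) (iota i)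
above-split zero    []      r n _ p _ = subst (λ m → r ↭ iota m) (≡.sym (↭-iota-length p)) p , refl
above-split (suc i) (x ∷ l) r zero e p _ with () ← ↭-length p
above-split (suc i) (x ∷ l) r (suc n) e p (a ∷ as) with ∈-++⁻ (x ∷ l) (∈-resp-↭ (↭-sym p) (here ≡.refl))
... | inj₂ q = ⊥-elim (ℕₚ.<⇒≱ (All.lookup a q) (All.lookup (↭-iota-≤ p) (here ≡.refl)))
... | inj₁ q with l₁ , l₂ , eq ← ∈-∃++ q rewrite eq
  = proj₁ IH , trans (shift (suc n) l₁ l₂) (subst (λ t → suc n ∷ l₁ ++ l₂ ↭ t ∷ map (length r +_) (iota i)) n≡ (prep _ (proj₂ IH)))
  where
  as' : All (Above r) (l₁ ++ suc n ∷ l₂)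
  as' = subst (All (Above r)) eq (a ∷ as)
  p' : l₁ ++ l₂ ++ r ↭ iota n
  p' = drop-mid l₁ [] (subst (_↭ iota (suc n)) (≡.trans (cong (_++ r) eq) (++-assoc l₁ (suc n ∷ l₂) r)) p)
  len : length (l₁ ++ l₂) ≡ i
  len = ℕₚ.suc-injective (≡.trans (≡.sym (↭-length (shift (suc n) l₁ l₂))) (≡.trans (cong length (≡.sym eq)) e))
  q' : (l₁ ++ l₂) ++ r ↭ iota n
  q' = subst (_↭ iota n) (≡.sym (++-assoc l₁ l₂ r)) p'
  IH = above-split i (l₁ ++ l₂) r n len q'
         (Allₚ.++⁺ (Allₚ.++⁻ˡ l₁ as') (All.tail (Allₚ.++⁻ʳ l₁ as')))
  n≡ : suc n ≡ length r + suc i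
  n≡ = ≡.trans (cong suc (≡.trans (≡.sym (↭-iota-length q')) (≡.trans (length-++ (l₁ ++ l₂))
         (≡.trans (cong (_+ length r) len) (ℕₚ.+-comm i (length r)))))) (≡.sym (ℕₚ.+-suc (length r) i))

unshift : ∀ l m i → l ↭ map (m +_) (iota i) → ∃ λ α → l ≡ map (m +_) α × α ↭ iota i
unshift l m i p = let α , e , q = ↭-map-inv (m +_) (↭-sym p) in α , e , ↭-sym q

unique-++-≢ : ∀ {l r : List ℕ} → Unique (l ++ r) → All (λ x → All (x ≢_) r) l
unique-++-≢ {[]}    _       = []
unique-++-≢ {x ∷ l} (p ∷ u) = Allₚ.++⁻ʳ l p ∷ unique-++-≢ u

head-max : ∀ {m a r} → a ∷ r ↭ iota m → All (_< a) r → a ≡ m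
head-max {zero}  p _ with () ← ↭-length p
head-max {suc m} p below with ∈-resp-↭ (↭-sym p) (here ≡.refl)
... | here e  = ≡.sym e
... | there q = ⊥-elim (ℕₚ.<⇒≱ (All.lookup below q) (All.head (↭-iota-≤ p)))

-- Nothing exceeds the top letter, so `suc m` is not `a` but the one letter of `r` above `a`. Hence
-- `a` is the maximum of all the others, which is `m`, and lowering `suc m` to `m` in `r` gives β.
raise-max : ∀ a r m → a ∷ r ↭ iota (suc m) → countB (a <ᵇ_) r ≡ 1 →
  ∃ λ β → β ↭ iota m × a ≡ m × r ≡ map (punch m) β × 1 ≤ m
raise-max a r m p c with ∈-resp-↭ (↭-sym p) (here ≡.refl)
... | here ≡.refl with z , z∈ , lt ← countB-pos a r (ℕₚ.≤-reflexive (≡.sym c))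
  = ⊥-elim (ℕₚ.<⇒≱ lt (All.lookup (↭-iota-≤ p) (there z∈)))
... | there q with r₁ , r₂ , ≡.refl ← ∈-∃++ q = r₁ ++ m ∷ r₂ , β↭ , a≡m , r≡ , 1≤m
  where
  p' : a ∷ r₁ ++ r₂ ↭ iota m
  p' = drop-mid (a ∷ r₁) [] p
  a≤m : a ≤ m
  a≤m = All.head (↭-iota-≤ p')
  count0 : countB (a <ᵇ_) (r₁ ++ r₂) ≡ 0
  count0 = ℕₚ.suc-injective (≡.trans (≡.sym (≡.trans (countB-∷ (a <ᵇ_) (suc m) (r₁ ++ r₂))
    (cong (λ b → χ b + countB (a <ᵇ_) (r₁ ++ r₂)) (<ᵇ-true (s≤s a≤m)))))
    (≡.trans (≡.sym (countB-↭ (a <ᵇ_) (shift (suc m) r₁ r₂))) c))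
  below : All (_< a) (r₁ ++ r₂)
  below = All.zipWith (λ { (le , ne) → ℕₚ.≤∧≢⇒< le (λ e → ne (≡.sym e)) })
    (countB-≡0 a (r₁ ++ r₂) count0 , AllPairs.head (↭-iota-unique p'))
  1≤m : 1 ≤ m
  1≤m = subst (1 ≤_) (↭-iota-length p') (s≤s z≤n)
  a≡m : a ≡ m
  a≡m = head-max p' below
  β↭ : r₁ ++ m ∷ r₂ ↭ iota m
  β↭ = trans (shift m r₁ r₂) (subst (λ t → t ∷ r₁ ++ r₂ ↭ iota m) a≡m p')
  fix : ∀ {s} → All (_< m) s → s ≡ map (punch m) s
  fix []       = ≡.refl
  fix (x ∷ xs) = cong₂ _∷_ (≡.sym (punch-< x)) (fix xs)
  r≡ : r₁ ++ suc m ∷ r₂ ≡ map (punch m) (r₁ ++ m ∷ r₂)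
  r≡ = go r₁ (Allₚ.++⁻ˡ r₁ below') (Allₚ.++⁻ʳ r₁ below')
    where
    below' = subst (λ t → All (_< t) (r₁ ++ r₂)) a≡m below
    go : ∀ s → All (_< m) s → All (_< m) r₂ → s ++ suc m ∷ r₂ ≡ map (punch m) (s ++ m ∷ r₂)
    go []      _        h = cong₂ _∷_ (≡.sym (punch-≥ ℕₚ.≤-refl)) (fix h)
    go (x ∷ s) (p ∷ ps) h = cong₂ _∷_ (≡.sym (punch-< p)) (go s ps h)

-- In `viaB` β is nonempty, since it carries the letter that exceeds the one before the maximum. In
-- both cases the sum counts all letters except the maximum.
data Decomposition (n : ℕ) : List ℕ → Set where
  viaA : ∀ {α β} i m → i + m ≡ n → α ∈ perms i → β ∈ perms m → Decomposition n (glueA α β)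
  viaB : ∀ {α β} i m → i + suc (suc m) ≡ n → α ∈ perms i → β ∈ perms (suc m) → Decomposition n (glueB α β)

decompose : ∀ n v → v ∈ perms (suc n) → occ132 v ≤ 1 → Decomposition n v
decompose n v v∈ le with v↭ ← ∈-perms⇒↭ (suc n) v∈
  with l , r , ≡.refl ← ∈-∃++ (∈-resp-↭ (↭-sym v↭) (here ≡.refl)) = go (shape (Allₚ.++⁻ʳ l bound) l distinct le)
  where
  lr : l ++ r ↭ iota n
  lr = drop-mid l [] v↭
  bound : All (_< suc n) (l ++ r)
  bound = All.map s≤s (↭-iota-≤ lr)
  distinct : All (λ x → All (x ≢_) r) l
  distinct = unique-++-≢ (↭-iota-unique lr)
  len : length l + length r ≡ n
  len = ≡.trans (≡.sym (length-++ l)) (↭-iota-length lr)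
  go : Shape r l → Decomposition n (l ++ suc n ∷ r)
  go (above a)
    with r↭ , l↭ ← above-split (length l) l r n ≡.refl lr a
    with α , l≡ , α↭ ← unshift l (length r) (length l) l↭
    = subst (Decomposition n) eq (viaA (length l) (length r) len (↭⇒∈-perms _ α↭) (↭⇒∈-perms _ r↭))
    where
    eq : glueA α r ≡ l ++ suc n ∷ r
    eq = cong₂ (λ s t → s ++ suc t ∷ r) (≡.sym l≡)
           (≡.trans (cong (_+ length r) (↭-iota-length α↭)) len)
  go (cross l' a ab c)
    with z , z∈ , a<z ← countB-pos a r (ℕₚ.≤-reflexive (≡.sym c))
    -- The letter `a` is counted with the right part: `l'` lies above `r`, in particular above z >
    -- a, hence above `a ∷ r`.
    with lar ← subst (_↭ iota n) (++-assoc l' (a ∷ []) r) lr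
    with ar↭ , l↭ ← above-split (length l') l' (a ∷ r) n ≡.refl lar
           (All.map (λ h → ℕₚ.<-trans a<z (All.lookup h z∈) ∷ h) ab)
    with α , l≡ , α↭ ← unshift l' (suc (length r)) (length l') l↭
    with β , β↭ , a≡ , r≡ , 1≤r ← raise-max a r (length r) ar↭ c
    = subst (Decomposition n) eq (viaB (length l') (length r ∸ 1)
        (≡.trans (cong (length l' +_) (cong suc len-r)) (≡.trans (≡.sym (length-++ l')) (↭-iota-length lar)))
        (↭⇒∈-perms _ α↭) (↭⇒∈-perms _ (subst (λ t → β ↭ iota t) (≡.sym len-r) β↭)))
    where
    len-r : suc (length r ∸ 1) ≡ length r
    len-r = ℕₚ.m+[n∸m]≡n {1} 1≤r
    |β| : length β ≡ length r
    |β| = ↭-iota-length β↭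
    n≡ : suc (length α + length β) ≡ n
    n≡ = ≡.trans (cong₂ (λ s t → suc (s + t)) (↭-iota-length α↭) |β|)
           (≡.trans (≡.sym (ℕₚ.+-suc (length l') (length r))) (≡.trans (≡.sym (length-++ l')) (↭-iota-length lar)))
    eq : glueB α β ≡ (l' ++ a ∷ []) ++ suc n ∷ r
    eq = begin
      map (suc (length β) +_) α ++ length β ∷ suc (suc (length α + length β)) ∷ map (punch (length β)) β
        ≡⟨ cong₂ (λ s t → map (suc s +_) α ++ s ∷ suc t ∷ map (punch s) β) |β| n≡ ⟩
      map (suc (length r) +_) α ++ length r ∷ suc n ∷ map (punch (length r)) β
        ≡⟨ cong₂ (λ s t → s ++ length r ∷ suc n ∷ t) (≡.sym l≡) (≡.sym r≡) ⟩
      l' ++ length r ∷ suc n ∷ r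
        ≡⟨ cong (λ t → l' ++ t ∷ suc n ∷ r) (≡.sym a≡) ⟩
      l' ++ a ∷ suc n ∷ r
        ≡⟨ ++-assoc l' (a ∷ []) (suc n ∷ r) ⟨
      (l' ++ a ∷ []) ++ suc n ∷ r ∎
      where open ≡.≡-Reasoning

iota-≥1 : ∀ n → All (1 ≤_) (iota n)
iota-≥1 zero    = []
iota-≥1 (suc n) = s≤s z≤n ∷ iota-≥1 n

iota-+ : ∀ i m → map (m +_) (iota i) ++ iota m ≡ iota (i + m)
iota-+ zero    m = ≡.refl
iota-+ (suc i) m = cong₂ _∷_ (≡.trans (ℕₚ.+-suc m i) (cong suc (ℕₚ.+-comm m i))) (iota-+ i m)

perms-length : ∀ n {v} → v ∈ perms n → length v ≡ n
perms-length n v∈ = ↭-iota-length (∈-perms⇒↭ n v∈)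

perms-≤ : ∀ n {v} → v ∈ perms n → All (_≤ n) v
perms-≤ n v∈ = ↭-iota-≤ (∈-perms⇒↭ n v∈)

punch-iota : ∀ m → map (punch (suc m)) (iota (suc m)) ≡ suc (suc m) ∷ iota m
punch-iota m = cong₂ _∷_ (punch-≥ {suc m} ℕₚ.≤-refl) (fix (iota-≤ m))
  where
  fix : ∀ {s} → All (_≤ m) s → map (punch (suc m)) s ≡ s
  fix []       = ≡.refl
  fix (x ∷ xs) = cong₂ _∷_ (punch-< (s≤s x)) (fix xs)

-- The gluings read their shifts off the lengths of their arguments, so as to be functions of two
-- words only; here the shifts become the numbers `i` and `m`.
glueA-form : ∀ i m {α β} → α ∈ perms i → β ∈ perms m →
  glueA α β ≡ map (m +_) α ++ suc (i + m) ∷ β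
glueA-form i m {β = β} α∈ β∈ rewrite perms-length i α∈ | perms-length m β∈ = ≡.refl

glueB-form : ∀ i m {α β} → α ∈ perms i → β ∈ perms m →
  glueB α β ≡ map (suc m +_) α ++ m ∷ suc (suc (i + m)) ∷ map (punch m) β
glueB-form i m {β = β} α∈ β∈ rewrite perms-length i α∈ | perms-length m β∈ = ≡.refl

glueA-∈ : ∀ i m {α β} → α ∈ perms i → β ∈ perms m → glueA α β ∈ perms (suc (i + m))
glueA-∈ i m {α} {β} α∈ β∈ = subst (_∈ perms (suc (i + m))) (≡.sym (glueA-form i m α∈ β∈))
  (↭⇒∈-perms _ (trans (shift _ (map (m +_) α) β) (prep _ (subst (_ ↭_) (iota-+ i m)
    (↭ₚ.++⁺ (↭ₚ.map⁺ (m +_) (∈-perms⇒↭ i α∈)) (∈-perms⇒↭ m β∈))))))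

glueB-∈ : ∀ i m {α β} → α ∈ perms i → β ∈ perms (suc m) → glueB α β ∈ perms (suc (i + suc (suc m)))
glueB-∈ i m {α} {β} α∈ β∈ = subst (_∈ perms (suc (i + suc (suc m)))) (≡.sym eq)
  (↭⇒∈-perms _ (trans (shift _ (l ++ suc m ∷ []) r) (prep _ (subst ((l ++ suc m ∷ []) ++ r ↭_) (iota-+ i (suc (suc m))) rest))))
  where
  l = map (suc (suc m) +_) α
  r = map (punch (suc m)) β
  eq : glueB α β ≡ (l ++ suc m ∷ []) ++ suc (i + suc (suc m)) ∷ r
  eq = ≡.trans (glueB-form i (suc m) α∈ β∈) (≡.trans
    (cong (λ t → l ++ suc m ∷ t ∷ r) (cong suc (≡.sym (ℕₚ.+-suc i (suc m)))))
    (≡.sym (++-assoc l (suc m ∷ []) _)))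
  rest : (l ++ suc m ∷ []) ++ r ↭ map (suc (suc m) +_) (iota i) ++ iota (suc (suc m))
  rest = subst (_↭ _) (≡.sym (++-assoc l (suc m ∷ []) r)) (↭ₚ.++⁺ (↭ₚ.map⁺ _ (∈-perms⇒↭ i α∈))
    (trans (prep (suc m) (subst (r ↭_) (punch-iota m) (↭ₚ.map⁺ (punch (suc m)) (∈-perms⇒↭ (suc m) β∈))))
      (swap _ _ refl)))

punch-mono : ∀ m x y → (punch m x <ᵇ punch m y) ≡ (x <ᵇ y)
punch-mono m x y with x <ᵇ m in p | y <ᵇ m in q
... | true  | true  = ≡.refl
... | false | false = ≡.refl
... | true  | false with lt ← ℕₚ.≤-trans (<ᵇ-true⁻ x m p) (<ᵇ-false⁻ y m q) =
  ≡.trans (<ᵇ-true (ℕₚ.m<n⇒m<1+n lt)) (≡.sym (<ᵇ-true lt))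
... | false | true  with lt ← ℕₚ.<-≤-trans (<ᵇ-true⁻ y m q) (<ᵇ-false⁻ x m p) =
  ≡.trans (<ᵇ-false {suc x} (ℕₚ.<⇒≤ (ℕₚ.m<n⇒m<1+n lt))) (≡.sym (<ᵇ-false (ℕₚ.<⇒≤ lt)))

punch-injective : ∀ m {x y} → punch m x ≡ punch m y → x ≡ y
punch-injective m {x} {y} e with ℕₚ.<-cmp x y
... | tri≈ _ eq _ = eq
... | tri< lt _ _ with () ← ≡.trans (≡.sym (<ᵇ-true lt)) (≡.trans (≡.sym (punch-mono m x y))
                              (<ᵇ-false (ℕₚ.≤-reflexive (≡.sym e))))
... | tri> _ _ gt with () ← ≡.trans (≡.sym (<ᵇ-true gt)) (≡.trans (≡.sym (punch-mono m y x))
                              (<ᵇ-false (ℕₚ.≤-reflexive e)))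

private
  -- This is what lets `split-unique` recover the cut from the glued word.
  max∉A : ∀ i m {n α} → i + m ≡ n → α ∈ perms i → suc n ∉ map (m +_) α
  max∉A i m ≡.refl α∈ p with a , a∈ , eq ← ∈-map⁻ (m +_) p =
    ℕₚ.<⇒≱ (ℕₚ.n<1+n (i + m)) (ℕₚ.≤-trans (ℕₚ.≤-reflexive eq) (ℕₚ.≤-trans
      (ℕₚ.+-monoʳ-≤ m (All.lookup (perms-≤ i α∈) a∈)) (ℕₚ.≤-reflexive (ℕₚ.+-comm m i))))

  formA : ∀ i m {n α β} → i + m ≡ n → α ∈ perms i → β ∈ perms m → glueA α β ≡ map (m +_) α ++ suc n ∷ β
  formA i m ≡.refl = glueA-form i m

  prefixB : ℕ → List ℕ → List ℕ
  prefixB m α = map (suc (suc m) +_) α ++ suc m ∷ []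

  formB : ∀ i m {n α β} → i + suc (suc m) ≡ n → α ∈ perms i → β ∈ perms (suc m) →
    glueB α β ≡ prefixB m α ++ suc n ∷ map (punch (suc m)) β
  formB i m {α = α} {β} ≡.refl α∈ β∈ = ≡.trans (glueB-form i (suc m) α∈ β∈) (≡.trans
    (cong (λ t → map (suc (suc m) +_) α ++ suc m ∷ t ∷ map (punch (suc m)) β)
      (cong suc (≡.sym (ℕₚ.+-suc i (suc m)))))
    (≡.sym (++-assoc (map (suc (suc m) +_) α) (suc m ∷ []) _)))

  max∉B : ∀ i m {n α} → i + suc (suc m) ≡ n → α ∈ perms i → suc n ∉ prefixB m α
  max∉B i m {α = α} e α∈ p with ∈-++⁻ (map (suc (suc m) +_) α) p
  ... | inj₁ q = max∉A i (suc (suc m)) e α∈ q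
  ... | inj₂ (here eq) = ℕₚ.<⇒≢ (ℕₚ.<-trans (ℕₚ.n<1+n (suc m)) (s≤s
          (ℕₚ.≤-trans (ℕₚ.m≤n+m (suc (suc m)) i) (ℕₚ.≤-reflexive e)))) (≡.sym eq)

-- The lengths on the two sides may differ, so that the blocks of `gluesA` with different `i` are
-- separated as well.
glueA-injective : ∀ {n} i m i' m' {α β α' β'} → i + m ≡ n → α ∈ perms i → β ∈ perms m →
  i' + m' ≡ n → α' ∈ perms i' → β' ∈ perms m' → glueA α β ≡ glueA α' β' → α ≡ α' × β ≡ β'
glueA-injective i m i' m' {β = β} e α∈ β∈ e' α∈' β∈' eq
  with l≡ , ≡.refl ← split-unique _ _ (max∉A i m e α∈) (max∉A i' m' e' α∈')
         (≡.trans (≡.sym (formA i m e α∈ β∈)) (≡.trans eq (formA i' m' e' α∈' β∈')))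
  with ≡.refl ← ≡.trans (≡.sym (perms-length m β∈)) (perms-length m' β∈')
  = map-injective (ℕₚ.+-cancelˡ-≡ m _ _) l≡ , ≡.refl

glueB-injective : ∀ {n} i m i' m' {α β α' β'} → i + suc (suc m) ≡ n → α ∈ perms i → β ∈ perms (suc m) →
  i' + suc (suc m') ≡ n → α' ∈ perms i' → β' ∈ perms (suc m') → glueB α β ≡ glueB α' β' → α ≡ α' × β ≡ β'
glueB-injective i m i' m' {α} {β} {α'} {β'} e α∈ β∈ e' α∈' β∈' eq
  with l≡ , r≡ ← split-unique _ _ (max∉B i m e α∈) (max∉B i' m' e' α∈')
         (≡.trans (≡.sym (formB i m e α∈ β∈)) (≡.trans eq (formB i' m' e' α∈' β∈')))
  with ≡.refl ← ≡.trans (≡.sym (perms-length (suc m) β∈)) (≡.trans (≡.trans (≡.sym (length-map _ β))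
         (≡.trans (cong length r≡) (length-map _ β'))) (perms-length (suc m') β∈'))
  = map-injective (ℕₚ.+-cancelˡ-≡ (suc (suc m)) _ _) (++-cancelʳ _ _ _ l≡)
  , map-injective (punch-injective (suc m)) r≡

-- Equality would force β and β' to have the same length. That number occurs before the maximum in
-- the second word, whereas all letters there exceed it in the first.
glueA≢glueB : ∀ {n} i m i' m' {α β α' β'} → i + m ≡ n → α ∈ perms i → β ∈ perms m →
  i' + suc (suc m') ≡ n → α' ∈ perms i' → β' ∈ perms (suc m') → glueA α β ≢ glueB α' β'
glueA≢glueB i m i' m' {α} {β} {α'} {β'} e α∈ β∈ e' α∈' β∈' eq
  with l≡ , r≡ ← split-unique _ _ (max∉A i m e α∈) (max∉B i' m' e' α∈')
         (≡.trans (≡.sym (formA i m e α∈ β∈)) (≡.trans eq (formB i' m' e' α∈' β∈')))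
  with ≡.refl ← ≡.trans (≡.sym (perms-length m β∈)) (≡.trans (≡.trans (cong length r≡) (length-map _ β'))
         (perms-length (suc m') β∈'))
  with a , a∈ , e₁ ← ∈-map⁻ (suc m' +_) (subst (suc m' ∈_) (≡.sym l≡)
         (∈-++⁺ʳ (map (suc (suc m') +_) α') (here ≡.refl)))
  = ℕₚ.<⇒≢ (ℕₚ.m<m+n (suc m') (All.lookup (All-resp-↭ (↭-sym (∈-perms⇒↭ i α∈)) (iota-≥1 i)) a∈)) e₁

-- Enumeration of the glued words

gluesA : ℕ → List (List ℕ)
gluesA n = concatTo (suc n) (λ i → cartesianProductWith glueA (perms i) (perms (n ∸ i)))

-- Empty for n < 2, because the words have length `suc n` and contain the three letters of the
-- crossing occurrence.
gluesB : ℕ → List (List ℕ)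
gluesB (suc (suc n)) = concatTo (suc n) (λ i → cartesianProductWith glueB (perms i) (perms (suc (n ∸ i))))
gluesB _             = []

private
  sumB : ∀ {i n} → i ≤ n → i + suc (suc (n ∸ i)) ≡ suc (suc n)
  sumB {i} {n} le = ≡.trans (ℕₚ.+-suc i (suc (n ∸ i))) (cong suc (≡.trans (ℕₚ.+-suc i (n ∸ i)) (cong suc (ℕₚ.m+[n∸m]≡n le))))

gluesA-unique : ∀ n → Unique (gluesA n)
gluesA-unique n = concatTo-unique (suc n) _
  (λ { i (s≤s i≤n) → cartesianProductWith-unique glueA (perms-unique i) (perms-unique (n ∸ i))
         λ p q p' q' → glueA-injective i (n ∸ i) i (n ∸ i) (ℕₚ.m+[n∸m]≡n i≤n) p q (ℕₚ.m+[n∸m]≡n i≤n) p' q' })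
  λ { {i} {j} (s≤s i≤n) (s≤s j≤n) p q → index i≤n j≤n
        (∈-cartesianProductWith⁻ glueA (perms i) (perms (n ∸ i)) p)
        (∈-cartesianProductWith⁻ glueA (perms j) (perms (n ∸ j)) q) }
  where
  index : ∀ {i j v} → i ≤ n → j ≤ n →
    (∃₂ λ α β → α ∈ perms i × β ∈ perms (n ∸ i) × v ≡ glueA α β) →
    (∃₂ λ α β → α ∈ perms j × β ∈ perms (n ∸ j) × v ≡ glueA α β) → i ≡ j
  index {i} {j} le le' (α , β , α∈ , β∈ , ≡.refl) (α' , β' , α∈' , β∈' , eq)
    with ≡.refl , _ ← glueA-injective i (n ∸ i) j (n ∸ j) (ℕₚ.m+[n∸m]≡n le) α∈ β∈ (ℕₚ.m+[n∸m]≡n le') α∈' β∈' eq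
    = ≡.trans (≡.sym (perms-length i α∈)) (perms-length j α∈')

gluesB-unique : ∀ n → Unique (gluesB n)
gluesB-unique zero       = []
gluesB-unique (suc zero) = []
gluesB-unique (suc (suc n)) = concatTo-unique (suc n) _
  (λ { i (s≤s i≤n) → cartesianProductWith-unique glueB (perms-unique i) (perms-unique (suc (n ∸ i)))
         λ p q p' q' → glueB-injective i (n ∸ i) i (n ∸ i) (sumB i≤n) p q (sumB i≤n) p' q' })
  λ { {i} {j} (s≤s i≤n) (s≤s j≤n) p q → index i≤n j≤n
        (∈-cartesianProductWith⁻ glueB (perms i) (perms (suc (n ∸ i))) p)
        (∈-cartesianProductWith⁻ glueB (perms j) (perms (suc (n ∸ j))) q) }
  where
  index : ∀ {i j v} → i ≤ n → j ≤ n →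
    (∃₂ λ α β → α ∈ perms i × β ∈ perms (suc (n ∸ i)) × v ≡ glueB α β) →
    (∃₂ λ α β → α ∈ perms j × β ∈ perms (suc (n ∸ j)) × v ≡ glueB α β) → i ≡ j
  index {i} {j} le le' (α , β , α∈ , β∈ , ≡.refl) (α' , β' , α∈' , β∈' , eq)
    with ≡.refl , _ ← glueB-injective i (n ∸ i) j (n ∸ j) (sumB le) α∈ β∈ (sumB le') α∈' β∈' eq
    = ≡.trans (≡.sym (perms-length i α∈)) (perms-length j α∈')

∈-gluesA⁻ : ∀ n {v} → v ∈ gluesA n → ∃₂ λ i m → ∃₂ λ α β → i + m ≡ n × α ∈ perms i × β ∈ perms m × v ≡ glueA α β
∈-gluesA⁻ n p with i , s≤s i≤n , q ← ∈-concatTo⁻ (suc n) p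
  with α , β , α∈ , β∈ , eq ← ∈-cartesianProductWith⁻ glueA (perms i) (perms (n ∸ i)) q
  = i , n ∸ i , α , β , ℕₚ.m+[n∸m]≡n i≤n , α∈ , β∈ , eq

∈-gluesB⁻ : ∀ n {v} → v ∈ gluesB n →
  ∃₂ λ i m → ∃₂ λ α β → i + suc (suc m) ≡ n × α ∈ perms i × β ∈ perms (suc m) × v ≡ glueB α β
∈-gluesB⁻ (suc (suc n)) p with i , s≤s i≤n , q ← ∈-concatTo⁻ (suc n) p
  with α , β , α∈ , β∈ , eq ← ∈-cartesianProductWith⁻ glueB (perms i) (perms (suc (n ∸ i))) q
  = i , n ∸ i , α , β , sumB i≤n , α∈ , β∈ , eq

∈-glues : ∀ {n v} → Decomposition n v → v ∈ gluesA n ++ gluesB n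
∈-glues (viaA i m ≡.refl α∈ β∈) = ∈-++⁺ˡ (∈-concatTo⁺ (suc (i + m)) (s≤s (ℕₚ.m≤m+n i m))
  (∈-cartesianProductWith⁺ glueA α∈ (subst (λ t → _ ∈ perms t) (≡.sym (ℕₚ.m+n∸m≡n i m)) β∈)))
∈-glues (viaB i m e α∈ β∈) with ≡.refl ← ≡.trans (≡.sym e) (≡.trans (ℕₚ.+-suc i (suc m)) (cong suc (ℕₚ.+-suc i m)))
  = ∈-++⁺ʳ (gluesA (suc (suc (i + m)))) (∈-concatTo⁺ (suc (i + m)) (s≤s (ℕₚ.m≤m+n i m))
  (∈-cartesianProductWith⁺ glueB α∈ (subst (λ t → _ ∈ perms (suc t)) (≡.sym (ℕₚ.m+n∸m≡n i m)) β∈)))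

countB-perms-suc : ∀ (P : List ℕ → Bool) n → (∀ {v} → P v ≡ true → occ132 v ≤ 1) →
  countB P (perms (suc n)) ≡ countB P (gluesA n) + countB P (gluesB n)
countB-perms-suc P n h = ≡.trans
  (countB-same P (perms (suc n)) (gluesA n ++ gluesB n) (perms-unique (suc n))
    (Uniqueₚ.++⁺ (gluesA-unique n) (gluesB-unique n) disjoint)
    (λ Pv v∈ → ∈-glues (decompose n _ v∈ (h Pv)))
    (λ _ → back))
  (countB-++ P (gluesA n) (gluesB n))
  where
  disjoint : Disjoint (gluesA n) (gluesB n)
  disjoint (p , q) with i , m , α , β , e , α∈ , β∈ , ≡.refl ← ∈-gluesA⁻ n p
    with i' , m' , α' , β' , e' , α∈' , β∈' , eq ← ∈-gluesB⁻ n q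
    = glueA≢glueB i m i' m' e α∈ β∈ e' α∈' β∈' eq
  back : ∀ {v} → v ∈ gluesA n ++ gluesB n → v ∈ perms (suc n)
  back p with ∈-++⁻ (gluesA n) p
  ... | inj₁ q with i , m , α , β , ≡.refl , α∈ , β∈ , ≡.refl ← ∈-gluesA⁻ n q = glueA-∈ i m α∈ β∈
  ... | inj₂ q with i , m , α , β , ≡.refl , α∈ , β∈ , ≡.refl ← ∈-gluesB⁻ n q = glueB-∈ i m α∈ β∈

-- Occurrences of 2-1-3-⋯-k

∧-true : ∀ {a b} → a ∧ b ≡ true → a ≡ true × b ≡ true
∧-true {true} e = ≡.refl , e

⇔⇒≡ : ∀ {a b} → (a ≡ true → b ≡ true) → (b ≡ true → a ≡ true) → a ≡ b
⇔⇒≡ {true}  {b}     f g = ≡.sym (f ≡.refl)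
⇔⇒≡ {false} {true}  f g = g ≡.refl
⇔⇒≡ {false} {false} f g = ≡.refl

anyB : {A : Set} → (A → Bool) → List A → Bool
anyB P []       = false
anyB P (x ∷ xs) = P x ∨ anyB P xs


countB-≡ᵇ0 : ∀ (P : A → Bool) xs → (countB P xs ≡ᵇ 0) ≡ not (anyB P xs)
countB-≡ᵇ0 P []       = ≡.refl
countB-≡ᵇ0 P (x ∷ xs) with P x
... | true  = ≡.refl
... | false = countB-≡ᵇ0 P xs

anyB-++ : ∀ (P : A → Bool) xs ys → anyB P (xs ++ ys) ≡ anyB P xs ∨ anyB P ys
anyB-++ P []       ys = ≡.refl
anyB-++ P (x ∷ xs) ys = ≡.trans (cong (P x ∨_) (anyB-++ P xs ys)) (≡.sym (∨-assoc (P x) _ _))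

anyB-map : ∀ (P : B → Bool) (f : A → B) xs → anyB P (map f xs) ≡ anyB (λ x → P (f x)) xs
anyB-map P f []       = ≡.refl
anyB-map P f (x ∷ xs) = cong (P (f x) ∨_) (anyB-map P f xs)

anyB-cong : ∀ {P Q : A → Bool} xs → All (λ x → P x ≡ Q x) xs → anyB P xs ≡ anyB Q xs
anyB-cong []       []       = ≡.refl
anyB-cong (x ∷ xs) (e ∷ es) = cong₂ _∨_ e (anyB-cong xs es)

anyB-∧ : ∀ b (P : A → Bool) xs → anyB (λ x → b ∧ P x) xs ≡ b ∧ anyB P xs
anyB-∧ true  P xs       = ≡.refl
anyB-∧ false P []       = ≡.refl
anyB-∧ false P (x ∷ xs) = anyB-∧ false P xs

allB⁻ : ∀ (P : A → Bool) {xs x} → allB P xs ≡ true → x ∈ xs → P x ≡ true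
allB⁻ P e (here ≡.refl) = proj₁ (∧-true e)
allB⁻ P {y ∷ _} e (there p) = allB⁻ P (proj₂ (∧-true {P y} e)) p

allB⁺ : ∀ (P : A → Bool) xs → (∀ {x} → x ∈ xs → P x ≡ true) → allB P xs ≡ true
allB⁺ P []       h = ≡.refl
allB⁺ P (x ∷ xs) h rewrite h (here ≡.refl) = allB⁺ P xs (λ p → h (there p))

-- has213 m is containment of the pattern of length m + 2; has213From fixes its
-- letter 2, and hasChain m b asks for the m letters that follow the prefix 2 1.
hasChain : ℕ → ℕ → List ℕ → Bool
hasChain zero    b _        = true
hasChain (suc m) b []       = false
hasChain (suc m) b (z ∷ zs) = ((b <ᵇ z) ∧ hasChain m z zs) ∨ hasChain (suc m) b zs

has213From : ℕ → ℕ → List ℕ → Bool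
has213From m x []       = false
has213From m x (y ∷ ys) = ((y <ᵇ x) ∧ hasChain m x ys) ∨ has213From m x ys

has213 : ℕ → List ℕ → Bool
has213 m []       = false
has213 m (x ∷ xs) = has213From m x xs ∨ has213 m xs

chain : ℕ → List ℕ → Bool
chain b []       = true
chain b (z ∷ zs) = (b <ᵇ z) ∧ chain z zs

subs-length : ∀ m (xs : List ℕ) → All (λ s → length s ≡ m) (subs m xs)
subs-length zero    xs       = ≡.refl ∷ []
subs-length (suc m) []       = []
subs-length (suc m) (x ∷ xs) =
  Allₚ.++⁺ (Allₚ.map⁺ (All.map (cong suc) (subs-length m xs))) (subs-length (suc m) xs)

Iso : List (ℕ × ℕ) → Set
Iso ps = ∀ {p q} → p ∈ ps → q ∈ ps → eqB (proj₁ p <ᵇ proj₁ q) (proj₂ p <ᵇ proj₂ q) ≡ true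

_≪_ : ℕ × ℕ → ℕ × ℕ → Set
p ≪ q = proj₁ p < proj₁ q × proj₂ p < proj₂ q

iso-chain : ∀ t x ts zs → length ts ≡ length zs → Linked _<_ (t ∷ ts) → Iso ((t , x) ∷ zip ts zs) → chain x zs ≡ true
iso-chain t x ts       []       _ _ _ = ≡.refl
iso-chain t x (u ∷ ts) (z ∷ zs) e (t<u ∷ l) iso
  rewrite ≡.sym (≡.trans (≡.sym (iso (here ≡.refl) (there (here ≡.refl)))) (cong (λ b → eqB b (x <ᵇ z)) (<ᵇ-true t<u)))
  = iso-chain u z ts zs (ℕₚ.suc-injective e) l (λ p q → iso (there p) (there q))

chain-linked : ∀ t x ts zs → Linked _<_ (t ∷ ts) → chain x zs ≡ true → Linked _≪_ ((t , x) ∷ zip ts zs)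
chain-linked t x []       zs       _         _ = [-]
chain-linked t x (u ∷ ts) []       _         _ = [-]
chain-linked t x (u ∷ ts) (z ∷ zs) (t<u ∷ l) c with x<z , c' ← ∧-true {x <ᵇ z} c =
  (t<u , <ᵇ-true⁻ x z x<z) ∷ chain-linked u z ts zs l c'

pairwise⇒iso : ∀ {ps} → AllPairs _≪_ ps → Iso ps
pairwise⇒iso (_ ∷ _)  (here {x = a , b} ≡.refl) (here ≡.refl) =
  cong₂ eqB (<ᵇ-false {a} ℕₚ.≤-refl) (<ᵇ-false {b} ℕₚ.≤-refl)
pairwise⇒iso (a ∷ _)  (here ≡.refl) (there q) with lt , lt' ← All.lookup a q =
  cong₂ eqB (<ᵇ-true lt) (<ᵇ-true lt')
pairwise⇒iso (a ∷ _)  (there p) (here ≡.refl) with lt , lt' ← All.lookup a p =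
  cong₂ eqB (<ᵇ-false (ℕₚ.<⇒≤ lt)) (<ᵇ-false (ℕₚ.<⇒≤ lt'))
pairwise⇒iso (_ ∷ as) (there p) (there q) = pairwise⇒iso as p q

≪-trans : ∀ {p q r} → p ≪ q → q ≪ r → p ≪ r
≪-trans (a , b) (c , d) = ℕₚ.<-trans a c , ℕₚ.<-trans b d

tail3 : ℕ → List ℕ
tail3 m = map (λ i → i + 3) (upTo m)

tail3-linked : ∀ m → Linked _<_ (2 ∷ tail3 m)
tail3-linked m = go m (λ i → i) (λ i → ℕₚ.n<1+n i) ℕₚ.≤-refl
  where
  -- The recursion of `upTo` shifts the enumerating function, so an arbitrary increasing `g` is
  -- carried along.
  go : ∀ m {t} (g : ℕ → ℕ) → (∀ i → g i < g (suc i)) → t < g 0 + 3 → Linked _<_ (t ∷ map (λ i → i + 3) (applyUpTo g m))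
  go zero    g h p = [-]
  go (suc m) g h p = p ∷ go m (λ i → g (suc i)) (λ i → h (suc i)) (ℕₚ.+-monoˡ-< 3 (h 0))

length-tail3 : ∀ m → length (tail3 m) ≡ m
length-tail3 m = ≡.trans (length-map _ (upTo m)) (length-upTo m)

≡ᵇ-refl : ∀ m → (m ≡ᵇ m) ≡ true
≡ᵇ-refl zero    = ≡.refl
≡ᵇ-refl (suc m) = ≡ᵇ-refl m

-- Pair the pattern letters with the word letters and swap the first two pairs: the right side says
-- that consecutive pairs increase in both coordinates, and transitivity settles all remaining
-- comparisons.
orderIso-213 : ∀ m x y zs → length zs ≡ m →
  orderIso (pat213k (suc (suc m))) (x ∷ y ∷ zs) ≡ (y <ᵇ x) ∧ chain x zs
orderIso-213 m x y zs e = ⇔⇒≡ to from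
  where
  ts = tail3 m
  ps = (2 , x) ∷ (1 , y) ∷ zip ts zs
  F : ℕ × ℕ → ℕ × ℕ → Bool
  F p q = eqB (proj₁ p <ᵇ proj₁ q) (proj₂ p <ᵇ proj₂ q)
  swap-∈ : ∀ {p} → p ∈ ps → p ∈ (1 , y) ∷ (2 , x) ∷ zip ts zs
  swap-∈ (here e)          = there (here e)
  swap-∈ (there (here e))  = here e
  swap-∈ (there (there p)) = there (there p)
  to : orderIso (pat213k (suc (suc m))) (x ∷ y ∷ zs) ≡ true → (y <ᵇ x) ∧ chain x zs ≡ true
  to h = cong₂ _∧_ (iso (there (here ≡.refl)) (here ≡.refl))
    (iso-chain 2 x ts zs (≡.trans (length-tail3 m) (≡.sym e)) (tail3-linked m)
      λ p q → iso (skip p) (skip q))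
    where
    iso : Iso ps
    iso {p} p∈ q∈ = allB⁻ (F p) (allB⁻ (λ p → allB (F p) ps)
      (proj₂ (∧-true {length (2 ∷ 1 ∷ ts) ≡ᵇ length (x ∷ y ∷ zs)} h)) p∈) q∈
    skip : ∀ {p} → p ∈ (2 , x) ∷ zip ts zs → p ∈ ps
    skip (here e)  = here e
    skip (there p) = there (there p)
  from : (y <ᵇ x) ∧ chain x zs ≡ true → orderIso (pat213k (suc (suc m))) (x ∷ y ∷ zs) ≡ true
  from h with y<x , c ← ∧-true {y <ᵇ x} h = cong₂ _∧_ len
    (allB⁺ _ ps (λ {p} p∈ → allB⁺ (F p) ps (λ q∈ → iso (swap-∈ p∈) (swap-∈ q∈))))
    where
    len : (length ts ≡ᵇ length zs) ≡ true
    len rewrite length-tail3 m | e = ≡ᵇ-refl m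
    iso : Iso ((1 , y) ∷ (2 , x) ∷ zip ts zs)
    iso = pairwise⇒iso (Linked⇒AllPairs (λ {p} {q} {r} → ≪-trans {p} {q} {r})
      ((ℕₚ.≤-refl , <ᵇ-true⁻ y x y<x) ∷ chain-linked 2 x ts zs (tail3-linked m) c))

anyB-chain : ∀ m b zs → anyB (chain b) (subs m zs) ≡ hasChain m b zs
anyB-chain zero    b zs       = ≡.refl
anyB-chain (suc m) b []       = ≡.refl
anyB-chain (suc m) b (z ∷ zs) = ≡.trans (anyB-++ (chain b) (map (z ∷_) (subs m zs)) (subs (suc m) zs))
  (cong₂ _∨_ (≡.trans (anyB-map (chain b) (z ∷_) (subs m zs))
    (≡.trans (anyB-∧ (b <ᵇ z) (chain z) (subs m zs)) (cong ((b <ᵇ z) ∧_) (anyB-chain m z zs))))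
    (anyB-chain (suc m) b zs))

occ-213 : ∀ m π → (occ (pat213k (suc (suc m))) π ≡ᵇ 0) ≡ not (has213 m π)
occ-213 m π = ≡.trans (countB-≡ᵇ0 Q (subs (length (pat213k (suc (suc m)))) π))
  (cong not (≡.trans (cong (λ t → anyB Q (subs (suc (suc t)) π)) (length-tail3 m)) (triples π)))
  where
  Q = orderIso (pat213k (suc (suc m)))
  pairs : ∀ x ys → anyB (λ s → Q (x ∷ s)) (subs (suc m) ys) ≡ has213From m x ys
  pairs x []       = ≡.refl
  pairs x (y ∷ ys) = ≡.trans (anyB-++ (λ s → Q (x ∷ s)) (map (y ∷_) (subs m ys)) (subs (suc m) ys))
    (cong₂ _∨_ (≡.trans (anyB-map (λ s → Q (x ∷ s)) (y ∷_) (subs m ys))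
      (≡.trans (anyB-cong (subs m ys) (All.map (orderIso-213 m x y _) (subs-length m ys)))
        (≡.trans (anyB-∧ (y <ᵇ x) (chain x) (subs m ys)) (cong ((y <ᵇ x) ∧_) (anyB-chain m x ys)))))
      (pairs x ys))
  triples : ∀ xs → anyB Q (subs (suc (suc m)) xs) ≡ has213 m xs
  triples []       = ≡.refl
  triples (x ∷ xs) = ≡.trans (anyB-++ Q (map (x ∷_) (subs (suc m) xs)) (subs (suc (suc m)) xs))
    (cong₂ _∨_ (≡.trans (anyB-map Q (x ∷_) (subs (suc m) xs)) (pairs x xs)) (triples xs))

-- Patterns and alternation in glued words

module _ (f : ℕ → ℕ) (mono : ∀ x y → (f x <ᵇ f y) ≡ (x <ᵇ y)) where

  twos-map : ∀ x y zs → twos (f x) (f y) (map f zs) ≡ twos x y zs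
  twos-map x y zs = ≡.trans (countB-map _ f zs) (countB-cong zs (λ {z} _ → cong₂ _∧_ (mono x z) (mono z y)))

  threeTwos-map : ∀ x ys → threeTwos (f x) (map f ys) ≡ threeTwos x ys
  threeTwos-map x []       = ≡.refl
  threeTwos-map x (y ∷ ys) = cong₂ _+_ (twos-map x y ys) (threeTwos-map x ys)

  occ132-map : ∀ xs → occ132 (map f xs) ≡ occ132 xs
  occ132-map []       = ≡.refl
  occ132-map (x ∷ xs) = cong₂ _+_ (threeTwos-map x xs) (occ132-map xs)

  hasChain-map : ∀ m b zs → hasChain m (f b) (map f zs) ≡ hasChain m b zs
  hasChain-map zero    b zs       = ≡.refl
  hasChain-map (suc m) b []       = ≡.refl
  hasChain-map (suc m) b (z ∷ zs) = cong₂ _∨_ (cong₂ _∧_ (mono b z) (hasChain-map m z zs)) (hasChain-map (suc m) b zs)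

  has213From-map : ∀ m x ys → has213From m (f x) (map f ys) ≡ has213From m x ys
  has213From-map m x []       = ≡.refl
  has213From-map m x (y ∷ ys) = cong₂ _∨_ (cong₂ _∧_ (mono y x) (hasChain-map m x ys)) (has213From-map m x ys)

  has213-map : ∀ m xs → has213 m (map f xs) ≡ has213 m xs
  has213-map m []       = ≡.refl
  has213-map m (x ∷ xs) = cong₂ _∨_ (has213From-map m x xs) (has213-map m xs)

  upFrom-map : ∀ b xs → upFrom b (map f xs) ≡ upFrom b xs
  upFrom-map b     []           = ≡.refl
  upFrom-map b     (x ∷ [])     = ≡.refl
  upFrom-map true  (x ∷ y ∷ xs) = cong₂ _∧_ (mono x y) (upFrom-map false (y ∷ xs))
  upFrom-map false (x ∷ y ∷ xs) = cong₂ _∧_ (mono y x) (upFrom-map true (y ∷ xs))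

+-mono : ∀ m x y → (m + x <ᵇ m + y) ≡ (x <ᵇ y)
+-mono zero    x y = ≡.refl
+-mono (suc m) x y = +-mono m x y

twos-low : ∀ {x} y r → All (_≤ x) r → twos x y r ≡ 0
twos-low y []      []       = ≡.refl
twos-low y (z ∷ r) (p ∷ ps) rewrite <ᵇ-false p = twos-low y r ps

threeTwos-low : ∀ {x} r → All (_≤ x) r → threeTwos x r ≡ 0
threeTwos-low []      []       = ≡.refl
threeTwos-low (z ∷ r) (p ∷ ps) = cong₂ _+_ (twos-low z r ps) (threeTwos-low r ps)

twos-below : ∀ {x y} r → y ≤ x → twos x y r ≡ 0
twos-below         []      _ = ≡.refl
twos-below {x} {y} (z ∷ r) p with x <ᵇ z in eq
... | false = twos-below r p
... | true rewrite <ᵇ-false (ℕₚ.≤-trans p (ℕₚ.<⇒≤ (<ᵇ-true⁻ x z eq))) = twos-below r p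

-- The 3 and the 2 would be two letters above `a`.
threeTwos-one : ∀ a r → countB (a <ᵇ_) r ≤ 1 → threeTwos a r ≡ 0
threeTwos-one a []      _ = ≡.refl
threeTwos-one a (y ∷ r) p with a <ᵇ y in eq
... | true with low ← countB-≡0 a r (ℕₚ.n≤0⇒n≡0 (ℕₚ.≤-pred p)) = cong₂ _+_ (twos-low y r low) (threeTwos-low r low)
... | false = cong₂ _+_ (twos-below r (<ᵇ-false⁻ a y eq)) (threeTwos-one a r p)

hasChain-low : ∀ m {b} r → All (_≤ b) r → hasChain (suc m) b r ≡ false
hasChain-low m []      []       = ≡.refl
hasChain-low m (z ∷ r) (p ∷ ps) rewrite <ᵇ-false p = hasChain-low m r ps

hasChain-one : ∀ m a r → countB (a <ᵇ_) r ≤ 1 → hasChain (suc (suc m)) a r ≡ false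
hasChain-one m a []      _ = ≡.refl
hasChain-one m a (y ∷ r) p with a <ᵇ y in eq
... | false = hasChain-one m a r p
... | true with low ← countB-≡0 a r (ℕₚ.n≤0⇒n≡0 (ℕₚ.≤-pred p))
  rewrite hasChain-low m r (All.map (λ q → ℕₚ.≤-trans q (ℕₚ.<⇒≤ (<ᵇ-true⁻ a y eq))) low) = hasChain-low (suc m) r low

hasChain-pos : ∀ a r → 1 ≤ countB (a <ᵇ_) r → hasChain 1 a r ≡ true
hasChain-pos a (y ∷ r) p with a <ᵇ y
... | true  = ≡.refl
... | false = hasChain-pos a r p

has213From-low : ∀ m {x} r → All (_≤ x) r → has213From (suc m) x r ≡ false
has213From-low m         []      []       = ≡.refl
has213From-low m {x} (z ∷ r) (p ∷ ps) rewrite hasChain-low m r ps | ∧-zeroʳ (z <ᵇ x) = has213From-low m r ps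

has213From-one : ∀ m a r → countB (a <ᵇ_) r ≤ 1 → has213From (suc (suc m)) a r ≡ false
has213From-one m a []      _ = ≡.refl
has213From-one m a (y ∷ r) p with le ← ℕₚ.≤-trans (ℕₚ.m≤n+m _ (χ (a <ᵇ y))) (ℕₚ.≤-trans (ℕₚ.≤-reflexive (≡.sym (countB-∷ (a <ᵇ_) y r))) p)
  rewrite hasChain-one m a r le | ∧-zeroʳ (y <ᵇ a) = has213From-one m a r le

-- The hypotheses rule out the two mixed kinds of occurrence: those with only the 1 in `l`, and
-- those with the 1 and the 3 in `l`.
occ132-++ : ∀ l s → All (λ x → threeTwos x s ≡ 0) l → All (λ x → All (λ y → twos x y s ≡ 0) l) l → occ132 (l ++ s) ≡ occ132 l + occ132 s
occ132-++ []      s _        _        = ≡.refl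
occ132-++ (x ∷ l) s (p ∷ ps) ((_ ∷ q) ∷ qs) = ≡.trans (cong₂ _+_ (row l q) (occ132-++ l s ps (All.map All.tail qs)))
  (≡.sym (ℕₚ.+-assoc (threeTwos x l) (occ132 l) (occ132 s)))
  where
  row : ∀ l → All (λ y → twos x y s ≡ 0) l → threeTwos x (l ++ s) ≡ threeTwos x l
  row []      _        = p
  row (y ∷ l) (e ∷ es) = cong₂ _+_
    (≡.trans (countB-++ _ l s) (≡.trans (cong (_+_ (twos x y l)) e) (ℕₚ.+-identityʳ _))) (row l es)

-- Since `hasChain m b []` holds only for m = 0, the first hypothesis says that `s` can add exactly
-- one letter to a chain ending in `l`. So the pattern to be sought in `l` is shorter by one letter.
-- The second hypothesis excludes a 2 in `l` whose 1 lies in `s`.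
module _ (m : ℕ) (s : List ℕ) (L : ℕ → Set) (hasChain-s : ∀ m {b} → L b → hasChain (suc m) b s ≡ hasChain m b [])
  (has213From-s : ∀ {b} → L b → has213From (suc m) b s ≡ false) where

  hasChain-++ : ∀ m b l → L b → All L l → hasChain (suc m) b (l ++ s) ≡ hasChain m b l
  hasChain-++ m       b []      Lb _        = hasChain-s m Lb
  hasChain-++ zero    b (z ∷ l) Lb (p ∷ ps) rewrite hasChain-++ zero b l Lb ps = ∨-zeroʳ _
  hasChain-++ (suc m) b (z ∷ l) Lb (p ∷ ps) =
    cong₂ (λ u v → ((b <ᵇ z) ∧ u) ∨ v) (hasChain-++ m z l p ps) (hasChain-++ (suc m) b l Lb ps)

  has213From-++ : ∀ x l → L x → All L l → has213From (suc m) x (l ++ s) ≡ has213From m x l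
  has213From-++ x []      Lx _        = has213From-s Lx
  has213From-++ x (y ∷ l) Lx (p ∷ ps) = cong₂ (λ u v → ((y <ᵇ x) ∧ u) ∨ v) (hasChain-++ m x l Lx ps) (has213From-++ x l Lx ps)

  has213-++ : ∀ l → All L l → has213 (suc m) (l ++ s) ≡ has213 m l ∨ has213 (suc m) s
  has213-++ []      _        = ≡.refl
  has213-++ (x ∷ l) (p ∷ ps) rewrite has213From-++ x l p ps | has213-++ l ps = ≡.sym (∨-assoc (has213From m x l) _ _)

upFrom-max : ∀ {N} r → All (_< N) r → upFrom false (N ∷ r) ≡ upFrom true r
upFrom-max []      _       = ≡.refl
upFrom-max (y ∷ r) (p ∷ _) rewrite <ᵇ-true p = ≡.refl

upFrom-max-first : ∀ {N} r → All (_< N) r → 1 ≤ length r → upFrom true (N ∷ r) ≡ false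
upFrom-max-first (y ∷ r) (p ∷ _) _ rewrite <ᵇ-false (ℕₚ.<⇒≤ p) = ≡.refl

-- If the first letter y exceeded `a`, the ascent would put a second letter above `a`. So y < a, and
-- the letter above `a` comes later and completes a 2-1-3 with `a` and y.
has213From-ascent : ∀ a s → 2 ≤ length s → countB (a <ᵇ_) s ≡ 1 → a ∉ s → upFrom true s ≡ true → has213From 1 a s ≡ true
has213From-ascent a (y ∷ []) (s≤s ())
has213From-ascent a (y ∷ z ∷ s) _ c ∉s u with ℕₚ.<-cmp y a
... | tri≈ _ e _ = ⊥-elim (∉s (here (≡.sym e)))
... | tri< lt _ _ rewrite <ᵇ-true lt | <ᵇ-false {a} (ℕₚ.<⇒≤ lt)
  | hasChain-pos a (z ∷ s) (ℕₚ.≤-reflexive (≡.sym c)) = ≡.refl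
... | tri> _ _ gt rewrite <ᵇ-true gt = ⊥-elim (ℕₚ.<-asym gt (ℕₚ.<-≤-trans
        (<ᵇ-true⁻ y z (proj₁ (∧-true u))) (All.head (countB-≡0 a (z ∷ s) (ℕₚ.suc-injective c)))))

module _ {N : ℕ} {r : List ℕ} (r<N : All (_< N) r) where

  private
    r≤N : All (_≤ N) r
    r≤N = All.map ℕₚ.<⇒≤ r<N

  Between : ℕ → Set
  Between x = Above r x × x < N

  private
    low : ∀ {x} → Between x → All (_≤ x) r
    low (p , _) = All.map ℕₚ.<⇒≤ p

    twos-N : ∀ {x y} → Between x → Between y → twos x y (N ∷ r) ≡ 0
    twos-N {x} {y} bx by rewrite <ᵇ-false (ℕₚ.<⇒≤ (proj₂ by)) | ∧-zeroʳ (x <ᵇ N) = twos-low y r (low bx)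

    threeTwos-N : ∀ {x} → Between x → threeTwos x (N ∷ r) ≡ 0
    threeTwos-N bx = cong₂ _+_ (twos-low N r (low bx)) (threeTwos-low r (low bx))

    hasChain-N : ∀ m {b} → Between b → hasChain (suc m) b (N ∷ r) ≡ hasChain m b []
    hasChain-N zero    bb rewrite <ᵇ-true (proj₂ bb) = ≡.refl
    hasChain-N (suc m) {b} bb rewrite hasChain-low m r r≤N | ∧-zeroʳ (b <ᵇ N) = hasChain-low (suc m) r (low bb)

    has213From-N : ∀ m {x} → Between x → has213From (suc m) x (N ∷ r) ≡ false
    has213From-N m bx rewrite <ᵇ-false (ℕₚ.<⇒≤ (proj₂ bx)) = has213From-low m r (low bx)

    has213-N : ∀ m → has213 (suc m) (N ∷ r) ≡ has213 (suc m) r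
    has213-N m rewrite has213From-low m r r≤N = ≡.refl

  occ132-A : ∀ l → All Between l → occ132 (l ++ N ∷ r) ≡ occ132 l + occ132 r
  occ132-A l bs = ≡.trans (occ132-++ l (N ∷ r) (All.map threeTwos-N bs) (All.map (λ bx → All.map (twos-N bx) bs) bs))
    (cong (occ132 l +_) (cong (_+ occ132 r) (threeTwos-low r r≤N)))

  has213-A : ∀ m l → All Between l → has213 (suc m) (l ++ N ∷ r) ≡ has213 m l ∨ has213 (suc m) r
  has213-A m l bs = ≡.trans (has213-++ m (N ∷ r) Between hasChain-N (has213From-N m) l bs) (cong (has213 m l ∨_) (has213-N m))

  -- The step into N must be an ascent, which is the parity factor; the step out of N is always a
  -- descent and costs nothing.
  upFrom-A : ∀ b x l → All (_< N) (x ∷ l) →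
    upFrom b (x ∷ l ++ N ∷ r) ≡ upFrom b (x ∷ l) ∧ (eqB b (isOdd (length (x ∷ l))) ∧ upFrom true r)
  upFrom-A true  x [] (p ∷ _) rewrite <ᵇ-true p = upFrom-max r r<N
  upFrom-A false x [] (p ∷ _) rewrite <ᵇ-false (ℕₚ.<⇒≤ p) = ≡.refl
  upFrom-A true  x (y ∷ l) (_ ∷ ps) rewrite upFrom-A false y l ps | not-involutive (isOdd (length l)) =
    ≡.sym (∧-assoc (x <ᵇ y) _ _)
  upFrom-A false x (y ∷ l) (_ ∷ ps) rewrite upFrom-A true y l ps | not-involutive (isOdd (length l)) =
    ≡.sym (∧-assoc (y <ᵇ x) _ _)

  -- The one-letter word is set apart: it alternates although the prefix before N has even length 0.
  -- It returns as the summand x in `avoiders-init`.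
  upFrom-max-mid : ∀ l → All (_< N) l → 1 ≤ length l + length r →
    upFrom true (l ++ N ∷ r) ≡ upFrom true l ∧ (isOdd (length l) ∧ upFrom true r)
  upFrom-max-mid []      _  p = upFrom-max-first r r<N p
  upFrom-max-mid (x ∷ l) ps _ = upFrom-A true x l ps

  module _ {a : ℕ} (a<N : a < N) (one : countB (a <ᵇ_) r ≡ 1) where

    private
      one≤ : countB (a <ᵇ_) r ≤ 1
      one≤ = ℕₚ.≤-reflexive one

    BetweenB : ℕ → Set
    BetweenB x = Between x × a < x

    -- The added occurrence is a N b with b the only letter of `r` above `a`; another one starting
    -- at `a` would need two such letters.
    occ132-B : ∀ l → All BetweenB l → occ132 (l ++ a ∷ N ∷ r) ≡ occ132 l + suc (occ132 r)
    occ132-B l bs = ≡.trans (occ132-++ l (a ∷ N ∷ r) (All.map row bs) (All.map (λ bx → All.map (entry bx) bs) bs))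
      (cong (occ132 l +_) (cong₂ _+_ (cong₂ _+_ (≡.trans (twos-max a r r<N) one) (threeTwos-one a r one≤))
        (cong (_+ occ132 r) (threeTwos-low r r≤N))))
      where
      entry : ∀ {x y} → BetweenB x → BetweenB y → twos x y (a ∷ N ∷ r) ≡ 0
      entry (bx , a<x) (by , _) rewrite <ᵇ-false (ℕₚ.<⇒≤ a<x) = twos-N bx by
      row : ∀ {x} → BetweenB x → threeTwos x (a ∷ N ∷ r) ≡ 0
      row (bx , a<x) = cong₂ _+_ (twos-below (N ∷ r) (ℕₚ.<⇒≤ a<x)) (threeTwos-N bx)

    -- The pattern has at least four letters here. If a letter of `l` is its 2 and `a` its 1, only N
    -- can follow; if `a` is its 2, only one letter of `r` exceeds it. Both are too few. For 2-1-3
    -- itself they would be enough, which is the subject of `cross-213`.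
    has213-B : ∀ m l → All BetweenB l → has213 (suc (suc m)) (l ++ a ∷ N ∷ r) ≡ has213 (suc m) l ∨ has213 (suc (suc m)) r
    has213-B m l bs = ≡.trans (has213-++ (suc m) (a ∷ N ∷ r) BetweenB hasChain-aN has213From-aN l bs)
      (cong (has213 (suc m) l ∨_) has213-aN)
      where
      hasChain-aN : ∀ m {b} → BetweenB b → hasChain (suc m) b (a ∷ N ∷ r) ≡ hasChain m b []
      hasChain-aN m (bb , a<b) rewrite <ᵇ-false (ℕₚ.<⇒≤ a<b) = hasChain-N m bb
      has213From-aN : ∀ {x} → BetweenB x → has213From (suc (suc m)) x (a ∷ N ∷ r) ≡ false
      has213From-aN {x} (bx , a<x) rewrite hasChain-N (suc m) bx | ∧-zeroʳ (a <ᵇ x) = has213From-N (suc m) bx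
      has213-aN : has213 (suc (suc m)) (a ∷ N ∷ r) ≡ has213 (suc (suc m)) r
      has213-aN rewrite <ᵇ-false (ℕₚ.<⇒≤ a<N) | has213From-one m a r one≤ = has213-N (suc m)

    -- The letter `a` is smaller than its neighbours, hence a valley, and this fixes the parity of
    -- the prefix before it.
    upFrom-B : ∀ b l → All (a <_) l →
      upFrom b (l ++ a ∷ N ∷ r) ≡ (eqB (not b) (isOdd (length l)) ∧ upFrom b l) ∧ upFrom true r
    upFrom-B true  []       _       rewrite <ᵇ-true a<N = upFrom-max r r<N
    upFrom-B false []       _       rewrite <ᵇ-false (ℕₚ.<⇒≤ a<N) = ≡.refl
    upFrom-B true  (x ∷ []) (p ∷ _) rewrite <ᵇ-false (ℕₚ.<⇒≤ p) = ≡.refl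
    upFrom-B false (x ∷ []) (p ∷ _) rewrite <ᵇ-true p | <ᵇ-true a<N = upFrom-max r r<N
    upFrom-B true  (x ∷ y ∷ l) (_ ∷ ps) rewrite upFrom-B false (y ∷ l) ps =
      rearrange (x <ᵇ y) (isOdd (length l)) (upFrom false (y ∷ l)) (upFrom true r)
      where
      rearrange : ∀ c o u v → c ∧ ((not o ∧ u) ∧ v) ≡ (not (not (not o)) ∧ (c ∧ u)) ∧ v
      rearrange true  o     u v = cong (λ t → (t ∧ u) ∧ v) (≡.sym (not-involutive (not o)))
      rearrange false true  u v = ≡.refl
      rearrange false false u v = ≡.refl
    upFrom-B false (x ∷ y ∷ l) (_ ∷ ps) rewrite upFrom-B true (y ∷ l) ps =
      rearrange (y <ᵇ x) (isOdd (length l)) (upFrom true (y ∷ l)) (upFrom true r)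
      where
      rearrange : ∀ c o u v → c ∧ ((not (not o) ∧ u) ∧ v) ≡ (not (not o) ∧ (c ∧ u)) ∧ v
      rearrange true  o     u v = ≡.refl
      rearrange false true  u v = ≡.refl
      rearrange false false u v = ≡.refl

    has213From-before : ∀ {x} → a < x → x < N → ∀ l → has213From 1 x (l ++ a ∷ N ∷ r) ≡ true
    has213From-before a<x x<N []      rewrite <ᵇ-true a<x | <ᵇ-true x<N = ≡.refl
    has213From-before a<x x<N (_ ∷ l) rewrite has213From-before a<x x<N l = ∨-zeroʳ _

    -- Any x before `a` gives the 2-1-3 formed by x, `a`, N. If `l` is empty, `r` has at least two
    -- letters and `has213From-ascent` applies. The length bound leaves out exactly the word 1 3 2.
    cross-213 : ∀ l → All BetweenB l → a ∉ r → 2 ≤ length l + length r →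
      upFrom true r ∧ not (has213 1 (l ++ a ∷ N ∷ r)) ≡ false
    cross-213 (x ∷ l) (((_ , x<N) , a<x) ∷ _) _ _ rewrite has213From-before a<x x<N l = ∧-zeroʳ _
    cross-213 [] _ a∉r len with upFrom true r in u
    ... | false = ≡.refl
    ... | true rewrite has213From-ascent a r len one a∉r u | ∨-zeroʳ ((N <ᵇ a) ∧ hasChain 1 a r) = ≡.refl

-- Recurrences for the generating functions

-- q = true selects odd length; m stands for k - 2.
upAvoids : Bool → ℕ → List ℕ → Bool
upAvoids q m π = eqB q (isOdd (length π)) ∧ (upFrom true π ∧ not (has213 m π))

avoiding : Bool → ℕ → List ℕ → Bool
avoiding q m π = upAvoids q m π ∧ (occ132 π ≡ᵇ 0)

onceContaining : Bool → ℕ → List ℕ → Bool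
onceContaining q m π = upAvoids q m π ∧ (occ132 π ≡ᵇ 1)

isOdd-+ : ∀ a b → isOdd (a + b) ≡ (if isOdd a then not (isOdd b) else isOdd b)
isOdd-+ zero    b = ≡.refl
isOdd-+ (suc a) b rewrite isOdd-+ a b with isOdd a
... | true  = not-involutive _
... | false = ≡.refl

private
  ∧-shuffle : ∀ e ua ub ha hb → e ∧ ((ua ∧ ub) ∧ not (ha ∨ hb)) ≡ (ua ∧ not ha) ∧ (e ∧ (ub ∧ not hb))
  ∧-shuffle false ua    ub ha    hb = ≡.sym (∧-zeroʳ (ua ∧ not ha))
  ∧-shuffle true  false ub ha    hb = ≡.refl
  ∧-shuffle true  true  ub true  hb = ∧-zeroʳ ub
  ∧-shuffle true  true  ub false hb = ≡.refl

  -- Here `o` and `p` are the parities of α and β. An odd α together with N has even length, so β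
  -- inherits the parity `q` of the whole.
  upAvoids-parityA : ∀ q o p ua ub ha hb →
    eqB q (if o then not (not p) else not p) ∧ ((ua ∧ (o ∧ ub)) ∧ not (ha ∨ hb)) ≡
    (o ∧ (ua ∧ not ha)) ∧ (eqB q p ∧ (ub ∧ not hb))
  upAvoids-parityA q true  p ua ub ha hb rewrite not-involutive p = ∧-shuffle (eqB q p) ua ub ha hb
  upAvoids-parityA q false p ua ub ha hb rewrite ∧-zeroʳ ua = ∧-zeroʳ _

  upAvoids-parityB : ∀ q o p ua ub ha hb →
    eqB q (if o then not (not (not p)) else not (not p)) ∧ (((not o ∧ ua) ∧ ub) ∧ not (ha ∨ hb)) ≡
    (not o ∧ (ua ∧ not ha)) ∧ (eqB q p ∧ (ub ∧ not hb))
  upAvoids-parityB q false p ua ub ha hb rewrite not-involutive p = ∧-shuffle (eqB q p) ua ub ha hb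
  upAvoids-parityB q true  p ua ub ha hb = ∧-zeroʳ _

module GlueA (i m : ℕ) {α β : List ℕ} (α∈ : α ∈ perms i) (β∈ : β ∈ perms m) where

  private
    l = map (m +_) α

    r<N : All (_< suc (i + m)) β
    r<N = All.map (λ p → s≤s (ℕₚ.≤-trans p (ℕₚ.m≤n+m m i))) (perms-≤ m β∈)

    between : All (Between r<N) l
    between = Allₚ.map⁺ (All.zipWith (λ { {a} (1≤a , a≤i) →
      All.map (λ p → ℕₚ.<-≤-trans (s≤s p) (ℕₚ.≤-trans (ℕₚ.≤-reflexive (ℕₚ.+-comm 1 m)) (ℕₚ.+-monoʳ-≤ m 1≤a))) (perms-≤ m β∈) ,
      s≤s (ℕₚ.≤-trans (ℕₚ.+-monoʳ-≤ m a≤i) (ℕₚ.≤-reflexive (ℕₚ.+-comm m i))) })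
      (All-resp-↭ (↭-sym (∈-perms⇒↭ i α∈)) (iota-≥1 i) , perms-≤ i α∈))

  occ132-glueA : occ132 (glueA α β) ≡ occ132 α + occ132 β
  occ132-glueA rewrite glueA-form i m α∈ β∈ | occ132-A r<N l between | occ132-map (m +_) (+-mono m) α = ≡.refl

  upAvoids-glueA : ∀ q k → 1 ≤ i + m → upAvoids q (suc k) (glueA α β) ≡ upAvoids true k α ∧ upAvoids q (suc k) β
  upAvoids-glueA q k 1≤ rewrite glueA-form i m α∈ β∈ | has213-A r<N k l between | has213-map (m +_) (+-mono m) k α
    | length-++ l {suc (i + m) ∷ β} | isOdd-+ (length l) (suc (length β))
    | upFrom-max-mid r<N l (All.map proj₂ between)
        (subst (1 ≤_) (≡.sym (cong₂ _+_ (≡.trans (length-map (m +_) α) (perms-length i α∈)) (perms-length m β∈))) 1≤)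
    | upFrom-map (m +_) (+-mono m) true α | length-map (m +_) α
    = upAvoids-parityA q (isOdd (length α)) (isOdd (length β)) (upFrom true α) (upFrom true β) (has213 k α) (has213 (suc k) β)

module GlueB (i m : ℕ) {α β : List ℕ} (α∈ : α ∈ perms i) (β∈ : β ∈ perms (suc m)) where

  private
    l = map (suc (suc m) +_) α
    r = map (punch (suc m)) β
    N = suc (suc (i + suc m))

    r≤ : All (_≤ suc (suc m)) r
    r≤ = Allₚ.map⁺ (All.map bound (perms-≤ (suc m) β∈))
      where
      bound : ∀ {v} → v ≤ suc m → punch (suc m) v ≤ suc (suc m)
      bound {v} p with v <ᵇ suc m
      ... | true  = ℕₚ.m≤n⇒m≤1+n p
      ... | false = s≤s p

    m<N : suc (suc m) < N
    m<N = s≤s (s≤s (ℕₚ.m≤n+m (suc m) i))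

    r<N : All (_< N) r
    r<N = All.map (λ p → ℕₚ.≤-<-trans p m<N) r≤

    a<N : suc m < N
    a<N = ℕₚ.<-trans (ℕₚ.n<1+n (suc m)) m<N

    one : countB (suc m <ᵇ_) r ≡ 1
    one = ≡.trans (countB-↭ (suc m <ᵇ_) (↭ₚ.map⁺ (punch (suc m)) (∈-perms⇒↭ (suc m) β∈)))
      (≡.trans (cong (countB (suc m <ᵇ_)) (punch-iota m))
      (≡.trans (countB-∷ (suc m <ᵇ_) (suc (suc m)) (iota m))
        (cong₂ (λ b t → χ b + t) (<ᵇ-true (ℕₚ.n<1+n (suc m)))
          (countB-none (iota m) (λ p → <ᵇ-false (ℕₚ.m≤n⇒m≤1+n (All.lookup (iota-≤ m) p)))))))

    between : All (BetweenB r<N a<N one) l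
    between = Allₚ.map⁺ (All.zipWith (λ { {a} (1≤a , a≤i) →
      let lt = ℕₚ.<-≤-trans (ℕₚ.n<1+n (suc (suc m)))
                 (ℕₚ.≤-trans (ℕₚ.≤-reflexive (ℕₚ.+-comm 1 (suc (suc m)))) (ℕₚ.+-monoʳ-≤ (suc (suc m)) 1≤a)) in
      (All.map (λ p → ℕₚ.≤-<-trans p lt) r≤ ,
      s≤s (s≤s (ℕₚ.≤-trans (ℕₚ.≤-reflexive (≡.sym (ℕₚ.+-suc m a)))
        (ℕₚ.≤-trans (ℕₚ.≤-reflexive (ℕₚ.+-comm m (suc a)))
        (ℕₚ.≤-trans (ℕₚ.+-monoˡ-≤ m (s≤s a≤i)) (ℕₚ.≤-reflexive (≡.sym (ℕₚ.+-suc i m)))))))) ,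
      ℕₚ.<-trans (ℕₚ.n<1+n (suc m)) lt })
      (All-resp-↭ (↭-sym (∈-perms⇒↭ i α∈)) (iota-≥1 i) , perms-≤ i α∈))

  occ132-glueB : occ132 (glueB α β) ≡ occ132 α + suc (occ132 β)
  occ132-glueB rewrite glueB-form i (suc m) α∈ β∈ | occ132-B r<N a<N one l between | occ132-map (suc (suc m) +_) (+-mono (suc (suc m))) α
    | occ132-map (punch (suc m)) (punch-mono (suc m)) β = ≡.refl

  upAvoids-glueB : ∀ q k → upAvoids q (suc (suc k)) (glueB α β) ≡ upAvoids false (suc k) α ∧ upAvoids q (suc (suc k)) β
  upAvoids-glueB q k rewrite glueB-form i (suc m) α∈ β∈ | has213-B r<N a<N one k l between
    | has213-map (suc (suc m) +_) (+-mono (suc (suc m))) (suc k) α | has213-map (punch (suc m)) (punch-mono (suc m)) (suc (suc k)) β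
    | length-++ l {suc m ∷ N ∷ r} | isOdd-+ (length l) (suc (suc (length r)))
    | upFrom-B r<N a<N one true l (All.map proj₂ between)
    | upFrom-map (suc (suc m) +_) (+-mono (suc (suc m))) true α | upFrom-map (punch (suc m)) (punch-mono (suc m)) true β
    | length-map (suc (suc m) +_) α | length-map (punch (suc m)) β
    = upAvoids-parityB q (isOdd (length α)) (isOdd (length β)) (upFrom true α) (upFrom true β) (has213 (suc k) α) (has213 (suc (suc k)) β)

  private
      skipped : suc m ∉ r
      skipped p with v , _ , e ← ∈-map⁻ (punch (suc m)) p with v <ᵇ suc m in eq
      ... | true  = ℕₚ.<⇒≢ (<ᵇ-true⁻ v (suc m) eq) (≡.sym e)
      ... | false = ℕₚ.<⇒≢ (s≤s (<ᵇ-false⁻ v (suc m) eq)) e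
      len : 1 ≤ i + m → 2 ≤ length l + length r
      len 1≤ rewrite length-map (suc (suc m) +_) α | length-map (punch (suc m)) β | perms-length i α∈
        | perms-length (suc m) β∈ | ℕₚ.+-suc i m = s≤s 1≤

  upAvoids-glueB-213 : ∀ q → 1 ≤ i + m → upAvoids q 1 (glueB α β) ≡ false
  upAvoids-glueB-213 q 1≤ rewrite glueB-form i (suc m) α∈ β∈
    | upFrom-B r<N a<N one true l (All.map proj₂ between)
    | ∧-assoc (not (isOdd (length l)) ∧ upFrom true l) (upFrom true r) (not (has213 1 (l ++ suc m ∷ N ∷ r)))
    | cross-213 r<N a<N one l between skipped (len 1≤)
    | ∧-zeroʳ (not (isOdd (length l)) ∧ upFrom true l) = ∧-zeroʳ _

private
  -- The final 0 is the product of the two `never` factors in `countB-cartesian`.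
  χ-avoid : ∀ A B a b → χ ((A ∧ B) ∧ (a + b ≡ᵇ 0)) ≡ χ (A ∧ (a ≡ᵇ 0)) * χ (B ∧ (b ≡ᵇ 0)) + 0
  χ-avoid false B     a       b       = ≡.refl
  χ-avoid true  false a       b       = ≡.sym (≡.trans (ℕₚ.+-identityʳ _) (ℕₚ.*-zeroʳ (χ (a ≡ᵇ 0))))
  χ-avoid true  true  zero    zero    = ≡.refl
  χ-avoid true  true  zero    (suc b) = ≡.refl
  χ-avoid true  true  (suc a) b       = ≡.refl

  χ-once : ∀ A B a b → χ ((A ∧ B) ∧ (a + b ≡ᵇ 1)) ≡
    χ (A ∧ (a ≡ᵇ 1)) * χ (B ∧ (b ≡ᵇ 0)) + χ (A ∧ (a ≡ᵇ 0)) * χ (B ∧ (b ≡ᵇ 1))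
  χ-once false B     a             b       = ≡.refl
  χ-once true  false a             b       =
    ≡.sym (cong₂ _+_ (ℕₚ.*-zeroʳ (χ (a ≡ᵇ 1))) (ℕₚ.*-zeroʳ (χ (a ≡ᵇ 0))))
  χ-once true  true  zero          zero    = ≡.refl
  χ-once true  true  zero          (suc b) = ≡.sym (ℕₚ.+-identityʳ _)
  χ-once true  true  (suc zero)    zero    = ≡.refl
  χ-once true  true  (suc zero)    (suc b) = ≡.refl
  χ-once true  true  (suc (suc a)) b       = ≡.refl

  χ-cross : ∀ A B a b → χ ((A ∧ B) ∧ (a + suc b ≡ᵇ 1)) ≡ χ (A ∧ (a ≡ᵇ 0)) * χ (B ∧ (b ≡ᵇ 0)) + 0
  χ-cross A B a b rewrite ℕₚ.+-suc a b = χ-avoid A B a b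

never : List ℕ → Bool
never _ = false

countB-never : ∀ xs → countB never xs ≡ 0
countB-never []       = ≡.refl
countB-never (x ∷ xs) = countB-never xs

countB-concatTo : ∀ (P : List ℕ → Bool) m f g → (∀ i → i < m → pos (countB P (f i)) ≡ g i) →
  pos (countB P (concatTo m f)) ≡ sumTo m g
countB-concatTo P zero    f g h = ≡.refl
countB-concatTo P (suc m) f g h = ≡.trans (cong pos (countB-++ P (concatTo m f) (f m)))
  (≡.trans (ℤₚ.pos-+ (countB P (concatTo m f)) (countB P (f m)))
    (cong₂ ℤ._+_ (countB-concatTo P m f g (λ i i<m → h i (ℕₚ.m≤n⇒m≤1+n i<m))) (h m ℕₚ.≤-refl)))

avoiders : Bool → ℕ → PS
avoiders q m n = pos (countB (avoiding q m) (perms n))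

containers : Bool → ℕ → PS
containers q m n = pos (countB (onceContaining q m) (perms n))

private
  drop-never : ∀ x y xs ys → pos (x * y + countB never xs * countB never ys) ≡ pos x ℤ.* pos y
  drop-never x y xs ys rewrite countB-never xs | ℕₚ.+-identityʳ (x * y) = ℤₚ.pos-* x y

  gluesA-avoiding : ∀ q k n → 1 ≤ n →
    pos (countB (avoiding q (suc k)) (gluesA n)) ≡ (avoiders true k ⊛ avoiders q (suc k)) n
  gluesA-avoiding q k n 1≤n = countB-concatTo _ (suc n) _ _ λ { i (s≤s i≤n) →
    ≡.trans (cong pos (countB-cartesian glueA (avoiding true k) never (avoiding q (suc k)) never
      (perms i) (perms (n ∸ i)) λ {α} {β} α∈ β∈ →
        let open GlueA i (n ∸ i) α∈ β∈ in
        ≡.trans (cong χ (cong₂ (λ u v → u ∧ (v ≡ᵇ 0))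
          (upAvoids-glueA q k (ℕₚ.≤-trans 1≤n (ℕₚ.≤-reflexive (≡.sym (ℕₚ.m+[n∸m]≡n i≤n))))) occ132-glueA))
          (χ-avoid (upAvoids true k α) (upAvoids q (suc k) β) (occ132 α) (occ132 β))))
    (drop-never (countB (avoiding true k) (perms i)) _ (perms i) (perms (n ∸ i))) }

  gluesB-avoiding : ∀ q k n → countB (avoiding q k) (gluesB n) ≡ 0
  gluesB-avoiding q k n = countB-none (gluesB n) none
    where
    none : ∀ {v} → v ∈ gluesB n → avoiding q k v ≡ false
    none p with i , m , α , β , _ , α∈ , β∈ , ≡.refl ← ∈-gluesB⁻ n p
      rewrite GlueB.occ132-glueB i m α∈ β∈ | ℕₚ.+-suc (occ132 α) (occ132 β) = ∧-zeroʳ _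

  gluesA-once : ∀ q k n → pos (countB (onceContaining q (suc k)) (gluesA n)) ≡
    (containers true k ⊛ avoiders q (suc k) ⊕ avoiders true k ⊛ containers q (suc k)) n
  gluesA-once q k n = ≡.trans (countB-concatTo _ (suc n) _ _ λ { i (s≤s i≤n) →
    ≡.trans (cong pos (countB-cartesian glueA (onceContaining true k) (avoiding true k) (avoiding q (suc k))
      (onceContaining q (suc k)) (perms i) (perms (n ∸ i)) (entry i)))
      (≡.trans (ℤₚ.pos-+ (countB (onceContaining true k) (perms i) * countB (avoiding q (suc k)) (perms (n ∸ i))) _)
        (cong₂ ℤ._+_ (ℤₚ.pos-* (countB (onceContaining true k) (perms i)) _) (ℤₚ.pos-* (countB (avoiding true k) (perms i)) _))) })
    (sumTo-+ (suc n) (λ i → containers true k i ℤ.* avoiders q (suc k) (n ∸ i)) (λ i → avoiders true k i ℤ.* containers q (suc k) (n ∸ i)))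
    where
    entry : ∀ i {α β} → α ∈ perms i → β ∈ perms (n ∸ i) → χ (onceContaining q (suc k) (glueA α β)) ≡
      χ (onceContaining true k α) * χ (avoiding q (suc k) β) + χ (avoiding true k α) * χ (onceContaining q (suc k) β)
    entry i {α} {β} α∈ β∈ with 1 ℕ.≤? i + (n ∸ i)
    ... | yes p = ≡.trans (cong χ (cong₂ (λ u v → u ∧ (v ≡ᵇ 1)) (upAvoids-glueA q k p) occ132-glueA))
                    (χ-once (upAvoids true k α) (upAvoids q (suc k) β) (occ132 α) (occ132 β))
      where open GlueA i (n ∸ i) α∈ β∈
    -- Only the one-letter word is left. The factorisation of `upAvoids` may fail for it, but it
    -- contains no 1-3-2 and both sides vanish.
    ... | no p with i | n ∸ i | α∈ | β∈
    ...   | suc _ | _     | _           | _           = ⊥-elim (p (s≤s z≤n))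
    ...   | zero  | suc _ | _           | _           = ⊥-elim (p (s≤s z≤n))
    ...   | zero  | zero  | here ≡.refl | here ≡.refl = cong χ (∧-zeroʳ (upAvoids q (suc k) (glueA [] [])))

  -- The gluing itself supplies the one occurrence, so both factors avoid 1-3-2; `tail` records that
  -- β is nonempty.
  gluesB-once : ∀ q k n → pos (countB (onceContaining q (suc (suc k))) (gluesB (suc (suc n)))) ≡
    (avoiders false (suc k) ⊛ tail (avoiders q (suc (suc k)))) n
  gluesB-once q k n = countB-concatTo _ (suc n) _ _ λ { i (s≤s i≤n) →
    ≡.trans (cong pos (countB-cartesian glueB (avoiding false (suc k)) never (avoiding q (suc (suc k))) never
      (perms i) (perms (suc (n ∸ i))) λ {α} {β} α∈ β∈ →
        let open GlueB i (n ∸ i) α∈ β∈ in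
        ≡.trans (cong χ (cong₂ (λ u v → u ∧ (v ≡ᵇ 1)) (upAvoids-glueB q k) occ132-glueB))
          (χ-cross (upAvoids false (suc k) α) (upAvoids q (suc (suc k)) β) (occ132 α) (occ132 β))))
    (drop-never (countB (avoiding false (suc k)) (perms i)) _ (perms i) (perms (suc (n ∸ i)))) }

  gluesB-once-213 : ∀ q n → countB (onceContaining q 1) (gluesB (suc (suc (suc n)))) ≡ 0
  gluesB-once-213 q n = countB-none (gluesB (suc (suc (suc n)))) none
    where
    none : ∀ {v} → v ∈ gluesB (suc (suc (suc n))) → onceContaining q 1 v ≡ false
    none p with i , m , α , β , e , α∈ , β∈ , ≡.refl ← ∈-gluesB⁻ (suc (suc (suc n))) p
      rewrite GlueB.upAvoids-glueB-213 i m α∈ β∈ q (ℕₚ.≤-trans (s≤s z≤n) (ℕₚ.≤-reflexive (≡.sym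
        (ℕₚ.suc-injective (ℕₚ.suc-injective (≡.trans (≡.sym (≡.trans (ℕₚ.+-suc i (suc m)) (cong suc (ℕₚ.+-suc i m)))) e)))))) = ≡.refl

  ≡ᵇ⇒≡' : ∀ a b → (a ≡ᵇ b) ≡ true → a ≡ b
  ≡ᵇ⇒≡' a b e = ℕₚ.≡ᵇ⇒≡ a b (subst T (≡.sym e) tt)

  avoiding-suc : ∀ q k n → avoiders q k (suc n) ≡ pos (countB (avoiding q k) (gluesA n))
  avoiding-suc q k n = cong pos (≡.trans (countB-perms-suc (avoiding q k) n λ {v} e →
      ℕₚ.≤-trans (ℕₚ.≤-reflexive (≡ᵇ⇒≡' (occ132 v) 0 (proj₂ (∧-true {upAvoids q k v} e)))) z≤n)
    (≡.trans (cong (countB (avoiding q k) (gluesA n) +_) (gluesB-avoiding q k n)) (ℕₚ.+-identityʳ _)))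

  once-suc : ∀ q k n → containers q k (suc n) ≡
    pos (countB (onceContaining q k) (gluesA n)) ℤ.+ pos (countB (onceContaining q k) (gluesB n))
  once-suc q k n = ≡.trans (cong pos (countB-perms-suc (onceContaining q k) n λ {v} e →
      ℕₚ.≤-reflexive (≡ᵇ⇒≡' (occ132 v) 1 (proj₂ (∧-true {upAvoids q k v} e)))))
    (ℤₚ.pos-+ (countB (onceContaining q k) (gluesA n)) _)

-- The words that escape the cut: the single letter in odd length, the empty word in even length.
avoiders-init : Bool → PS
avoiders-init true  = xpow 1
avoiders-init false = xpow 0

avoiders-rec : ∀ q k → avoiders q (suc k) ≐ avoiders-init q ⊕ xpow 1 ⊛ (avoiders true k ⊛ avoiders q (suc k))
avoiders-rec true  k zero = ≡.sym (cong (λ t → pos 0 ℤ.+ t) (xpow-suc-⊛-zero 0 (avoiders true k ⊛ avoiders true (suc k))))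
avoiders-rec false k zero = ≡.sym (cong (λ t → pos 1 ℤ.+ t) (xpow-suc-⊛-zero 0 (avoiders true k ⊛ avoiders false (suc k))))
avoiders-rec q k (suc n) = ≡.trans (step q n) (cong (λ t → avoiders-init q (suc n) ℤ.+ t)
  (≡.sym (≡.trans (xpow-suc-⊛-suc 0 (avoiders true k ⊛ avoiders q (suc k)) n) (⊛-identityˡ (avoiders true k ⊛ avoiders q (suc k)) n))))
  where
  step : ∀ q n → avoiders q (suc k) (suc n) ≡ avoiders-init q (suc n) ℤ.+ (avoiders true k ⊛ avoiders q (suc k)) n
  step true  zero    = ≡.sym (cong (λ t → pos 1 ℤ.+ t) (⊛-zero (avoiders true k) (avoiders true (suc k))))
  step false zero    = ≡.sym (cong (λ t → pos 0 ℤ.+ t) (⊛-zero (avoiders true k) (avoiders false (suc k))))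
  step true  (suc n) = ≡.trans (avoiding-suc true (suc k) (suc n))
    (≡.trans (gluesA-avoiding true k (suc n) (s≤s z≤n)) (≡.sym (ℤₚ.+-identityˡ _)))
  step false (suc n) = ≡.trans (avoiding-suc false (suc k) (suc n))
    (≡.trans (gluesA-avoiding false k (suc n) (s≤s z≤n)) (≡.sym (ℤₚ.+-identityˡ _)))

-- The permutations in which the occurrence of 1-3-2 uses the maximum.
crossTerm : Bool → ℕ → PS
crossTerm q k zero    = pos 0
crossTerm q k (suc n) = pos (countB (onceContaining q k) (gluesB n))

containers-rec : ∀ q k → containers q (suc k) ≐
  xpow 1 ⊛ (containers true k ⊛ avoiders q (suc k) ⊕ avoiders true k ⊛ containers q (suc k)) ⊕ crossTerm q (suc k)
containers-rec q k zero = ≡.trans (cong (λ b → pos (χ b)) (∧-zeroʳ (upAvoids q (suc k) [])))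
  (≡.sym (≡.trans (ℤₚ.+-identityʳ _) (xpow-suc-⊛-zero 0 (containers true k ⊛ avoiders q (suc k) ⊕ avoiders true k ⊛ containers q (suc k)))))
containers-rec q k (suc n) = ≡.trans (once-suc q (suc k) n) (cong (λ t → t ℤ.+ crossTerm q (suc k) (suc n))
  (≡.trans (gluesA-once q k n) (≡.sym (≡.trans (xpow-suc-⊛-suc 0 F n) (⊛-identityˡ F n)))))
  where F = containers true k ⊛ avoiders q (suc k) ⊕ avoiders true k ⊛ containers q (suc k)

-- The coefficient 1 belongs to the word 1 3 2, the only crossing word that alternates and avoids
-- 2-1-3.
crossTerm-213 : crossTerm true 1 ≐ xpow 3
crossTerm-213 zero                      = ≡.refl
crossTerm-213 (suc zero)                = ≡.refl
crossTerm-213 (suc (suc zero))          = ≡.refl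
crossTerm-213 (suc (suc (suc zero)))    = ≡.refl
crossTerm-213 (suc (suc (suc (suc n)))) = cong pos (gluesB-once-213 true n)

crossTerm-213-even : crossTerm false 1 ≐ zeroPS
crossTerm-213-even zero                      = ≡.refl
crossTerm-213-even (suc zero)                = ≡.refl
crossTerm-213-even (suc (suc zero))          = ≡.refl
crossTerm-213-even (suc (suc (suc zero)))    = ≡.refl
crossTerm-213-even (suc (suc (suc (suc n)))) = cong pos (gluesB-once-213 false n)

-- Two factors x stand for the maximum and the letter before it; the third pays for the `tail`.
crossTerm-rec : ∀ q k → crossTerm q (suc (suc k)) ≐ xpow 3 ⊛ (avoiders false (suc k) ⊛ tail (avoiders q (suc (suc k))))
crossTerm-rec q k n = go n
  where
  F = avoiders false (suc k) ⊛ tail (avoiders q (suc (suc k)))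
  go : ∀ n → crossTerm q (suc (suc k)) n ≡ (xpow 3 ⊛ F) n
  go zero                = ≡.sym (xpow-suc-⊛-zero 2 F)
  go (suc zero)          = ≡.sym (≡.trans (xpow-suc-⊛-suc 2 F 0) (xpow-suc-⊛-zero 1 F))
  go (suc (suc zero))    = ≡.sym (≡.trans (xpow-suc-⊛-suc 2 F 1) (≡.trans (xpow-suc-⊛-suc 1 F 0) (xpow-suc-⊛-zero 0 F)))
  go (suc (suc (suc n))) = ≡.trans (gluesB-once q k n) (≡.sym (≡.trans (xpow-suc-⊛-suc 2 F (suc (suc n)))
    (≡.trans (xpow-suc-⊛-suc 1 F (suc n)) (≡.trans (xpow-suc-⊛-suc 0 F n) (⊛-identityˡ F n)))))

-- Solving the recurrences

-- The anchor k = 2, with pattern 2-1: two letters have the wrong parity, and from three letters on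
-- alternation forces a descent.
upAvoids-21 : ∀ π → 2 ≤ length π → upAvoids true 0 π ≡ false
upAvoids-21 (x ∷ [])        (s≤s ())
upAvoids-21 (x ∷ y ∷ [])    _ = ≡.refl
upAvoids-21 (x ∷ y ∷ z ∷ π) _ with z <ᵇ y
... | false rewrite ∧-zeroʳ (x <ᵇ y) = ∧-zeroʳ _
... | true rewrite ∨-zeroʳ (has213From 0 x (y ∷ z ∷ π)) | ∧-zeroʳ ((x <ᵇ y) ∧ upFrom true (z ∷ π)) = ∧-zeroʳ _

avoiders-21 : avoiders true 0 ≐ xpow 1
avoiders-21 zero          = ≡.refl
avoiders-21 (suc zero)    = ≡.refl
avoiders-21 (suc (suc n)) = cong pos (countB-none (perms (suc (suc n))) λ {π} p →
  cong (_∧ (occ132 π ≡ᵇ 0)) (upAvoids-21 π (ℕₚ.≤-trans (s≤s (s≤s z≤n)) (ℕₚ.≤-reflexive (≡.sym (perms-length (suc (suc n)) p))))))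

containers-21 : containers true 0 ≐ zeroPS
containers-21 zero          = ≡.refl
containers-21 (suc zero)    = ≡.refl
containers-21 (suc (suc n)) = cong pos (countB-none (perms (suc (suc n))) λ {π} p →
  cong (_∧ (occ132 π ≡ᵇ 1)) (upAvoids-21 π (ℕₚ.≤-trans (s≤s (s≤s z≤n)) (ℕₚ.≤-reflexive (≡.sym (perms-length (suc (suc n)) p))))))

private
  regroup : ∀ o u c h → (o ∧ u) ∧ (c ∧ h) ≡ (o ∧ (u ∧ h)) ∧ c
  regroup false u     c     h = ≡.refl
  regroup true  false c     h = ≡.refl
  regroup true  true  true  h = ≡.sym (∧-identityʳ h)
  regroup true  true  false h = ≡.sym (∧-zeroʳ h)

-- The two predicates treat words of fewer than two letters differently before 1-3-2 is counted, but
-- such words contain no 1-3-2.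
UD≐containers : ∀ m → UD (suc (suc m)) ≐ containers true m
UD≐containers m n = cong pos (countB-cong (perms n) λ {π} _ → same π)
  where
  same : ∀ π → isUpDown π ∧ good (suc (suc m)) π ≡ onceContaining true m π
  same []           = ≡.refl
  same (x ∷ [])     = ≡.sym (∧-zeroʳ (upAvoids true m (x ∷ [])))
  same π@(_ ∷ _ ∷ _) rewrite occ-132 π | occ-213 m π = regroup (isOdd (length π)) (upFrom true π) (occ132 π ≡ᵇ 1) _

UU≐containers : ∀ m → UU (suc (suc m)) ≐ containers false m
UU≐containers m n = cong pos (countB-cong (perms n) λ {π} _ → same π)
  where
  same : ∀ π → isUpUp π ∧ good (suc (suc m)) π ≡ onceContaining false m π
  same []           = ≡.sym (∧-zeroʳ (upAvoids false m []))
  same (x ∷ [])     = ≡.refl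
  same π@(_ ∷ _ ∷ _) rewrite occ-132 π | occ-213 m π = regroup (not (isOdd (length π))) (upFrom true π) (occ132 π ≡ᵇ 1) _

-- Identities in a commutative semiring with cancellation

module SemiringLemmas (R : CommutativeSemiring 0ℓ 0ℓ)
  (cancel : ∀ x y z → CommutativeSemiring._≈_ R (CommutativeSemiring._+_ R x z) (CommutativeSemiring._+_ R y z) →
            CommutativeSemiring._≈_ R x y) where

  open CommutativeSemiring R renaming (Carrier to Car; _+_ to _⊞_; _*_ to _⊡_; sym to ≈-sym; refl to ≈-refl; trans to ≈-trans)
  open SemiringSolver R using (solve; _:+_; _:*_; _:=_; con)
  open SetoidReasoning setoid

  -- Multiply the equation for `F` by `B`: as (1 - XO)B = B - X²C = A, the unknown factor 1 - XO
  -- turns into `A`. This solves the recurrences for O, E and D alike.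
  linear : ∀ F I X O A B C → F ≈ I ⊞ X ⊡ (O ⊡ F) → O ⊡ B ≈ X ⊡ C → A ⊞ (X ⊡ X) ⊡ C ≈ B → F ⊡ A ≈ I ⊡ B
  linear F I X O A B C hF hO hW = cancel _ _ (F ⊡ ((X ⊡ X) ⊡ C)) (begin
    F ⊡ A ⊞ F ⊡ ((X ⊡ X) ⊡ C)       ≈⟨ distribˡ F A _ ⟨
    F ⊡ (A ⊞ (X ⊡ X) ⊡ C)           ≈⟨ *-cong hF hW ⟩
    (I ⊞ X ⊡ (O ⊡ F)) ⊡ B
      ≈⟨ solve 5 (λ f i x o b → (i :+ x :* (o :* f)) :* b := i :* b :+ (x :* f) :* (o :* b))
           ≈-refl F I X O B ⟩
    I ⊡ B ⊞ (X ⊡ F) ⊡ (O ⊡ B)       ≈⟨ +-congˡ (*-congˡ hO) ⟩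
    I ⊡ B ⊞ (X ⊡ F) ⊡ (X ⊡ C)
      ≈⟨ +-congˡ (solve 3 (λ f x c → (x :* f) :* (x :* c) := f :* ((x :* x) :* c)) ≈-refl F X C) ⟩
    I ⊡ B ⊞ F ⊡ ((X ⊡ X) ⊡ C)       ∎)

  -- A second factor `A` clears the series `S` and leaves `T₀` next to B², so that both unknowns
  -- carry the squares of their own denominators.
  quadratic : ∀ T X T₀ S K A B Y → T ⊡ A ≈ (X ⊡ (T₀ ⊡ S) ⊞ K) ⊡ B → S ⊡ A ≈ Y ⊡ B →
    T ⊡ A ⊡ A ≈ (X ⊡ Y) ⊡ (T₀ ⊡ B ⊡ B) ⊞ K ⊡ (A ⊡ B)
  quadratic T X T₀ S K A B Y hT hS = begin
    T ⊡ A ⊡ A                                      ≈⟨ *-congʳ hT ⟩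
    (X ⊡ (T₀ ⊡ S) ⊞ K) ⊡ B ⊡ A
      ≈⟨ solve 6 (λ x t s k a b → (x :* (t :* s) :+ k) :* b :* a := x :* (t :* b) :* (s :* a) :+ k :* (a :* b))
           ≈-refl X T₀ S K A B ⟩
    X ⊡ (T₀ ⊡ B) ⊡ (S ⊡ A) ⊞ K ⊡ (A ⊡ B)           ≈⟨ +-congʳ (*-congˡ hS) ⟩
    X ⊡ (T₀ ⊡ B) ⊡ (Y ⊡ B) ⊞ K ⊡ (A ⊡ B)
      ≈⟨ solve 6 (λ x t y k a b → x :* (t :* b) :* (y :* b) :+ k :* (a :* b) := (x :* y) :* (t :* b :* b) :+ k :* (a :* b))
           ≈-refl X T₀ Y K A B ⟩
    (X ⊡ Y) ⊡ (T₀ ⊡ B ⊡ B) ⊞ K ⊡ (A ⊡ B)           ∎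

  cross-odd : ∀ K X E t S A B C → K ≈ (X ⊡ X ⊡ X) ⊡ (E ⊡ t) → X ⊡ t ≈ S → E ⊡ B ≈ C → S ⊡ A ≈ X ⊡ B →
    K ⊡ (A ⊡ B) ≈ (X ⊡ X ⊡ X) ⊡ (B ⊡ C)
  cross-odd K X E t S A B C hK ht hE hS = begin
    K ⊡ (A ⊡ B)                                ≈⟨ *-congʳ hK ⟩
    (X ⊡ X ⊡ X) ⊡ (E ⊡ t) ⊡ (A ⊡ B)
      ≈⟨ solve 5 (λ x e t a b → (x :* x :* x) :* (e :* t) :* (a :* b) := (x :* x) :* (((x :* t) :* a) :* (e :* b)))
           ≈-refl X E t A B ⟩
    (X ⊡ X) ⊡ (((X ⊡ t) ⊡ A) ⊡ (E ⊡ B))        ≈⟨ *-congˡ (*-cong (≈-trans (*-congʳ ht) hS) hE) ⟩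
    (X ⊡ X) ⊡ ((X ⊡ B) ⊡ C)
      ≈⟨ solve 3 (λ x b c → (x :* x) :* ((x :* b) :* c) := (x :* x :* x) :* (b :* c)) ≈-refl X B C ⟩
    (X ⊡ X ⊡ X) ⊡ (B ⊡ C)                      ∎

  cross-even : ∀ K X E t S A B C → K ≈ (X ⊡ X ⊡ X) ⊡ (E ⊡ t) → X ⊡ t ⊞ 1# ≈ S → E ⊡ B ≈ C → S ⊡ A ≈ B →
    A ⊞ (X ⊡ X) ⊡ C ≈ B → X ⊡ (K ⊡ (A ⊡ B)) ≈ (X ⊡ X) ⊡ (X ⊡ X ⊡ X) ⊡ (C ⊡ C)
  cross-even K X E t S A B C hK ht hE hS hW = begin
    X ⊡ (K ⊡ (A ⊡ B))                                ≈⟨ *-congˡ (*-congʳ hK) ⟩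
    X ⊡ ((X ⊡ X ⊡ X) ⊡ (E ⊡ t) ⊡ (A ⊡ B))
      ≈⟨ solve 5 (λ x e t a b → x :* ((x :* x :* x) :* (e :* t) :* (a :* b)) := (x :* x :* x) :* ((x :* t :* a) :* (e :* b)))
           ≈-refl X E t A B ⟩
    (X ⊡ X ⊡ X) ⊡ ((X ⊡ t ⊡ A) ⊡ (E ⊡ B))            ≈⟨ *-congˡ (*-cong tA hE) ⟩
    (X ⊡ X ⊡ X) ⊡ ((X ⊡ X) ⊡ C ⊡ C)
      ≈⟨ solve 2 (λ x c → (x :* x :* x) :* ((x :* x) :* c :* c) := (x :* x) :* (x :* x :* x) :* (c :* c))
           ≈-refl X C ⟩
    (X ⊡ X) ⊡ (X ⊡ X ⊡ X) ⊡ (C ⊡ C)                  ∎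
    where
    -- Here X t is S without its constant term 1, so X t A = B - A, which the recurrence identifies
    -- as X²C.
    tA : X ⊡ t ⊡ A ≈ (X ⊡ X) ⊡ C
    tA = cancel _ _ A (begin
      X ⊡ t ⊡ A ⊞ A             ≈⟨ +-congˡ (*-identityˡ A) ⟨
      X ⊡ t ⊡ A ⊞ 1# ⊡ A        ≈⟨ distribʳ A (X ⊡ t) 1# ⟨
      (X ⊡ t ⊞ 1#) ⊡ A          ≈⟨ *-congʳ ht ⟩
      S ⊡ A                     ≈⟨ hS ⟩
      B                         ≈⟨ hW ⟨
      A ⊞ (X ⊡ X) ⊡ C           ≈⟨ +-comm A _ ⟩
      (X ⊡ X) ⊡ C ⊞ A           ∎)

  -- The determinant C² - DB of consecutive terms of the recurrence is multiplied by `Z` in each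
  -- step.
  cassini-step : ∀ Z Y A B C D → A ⊞ Z ⊡ C ≈ B → B ⊞ Z ⊡ D ≈ C → C ⊡ C ≈ D ⊡ B ⊞ Y → B ⊡ B ≈ C ⊡ A ⊞ Z ⊡ Y
  cassini-step Z Y A B C D hB hC h = cancel _ _ (Z ⊡ (D ⊡ B)) (begin
    B ⊡ B ⊞ Z ⊡ (D ⊡ B)
      ≈⟨ solve 3 (λ z b d → b :* b :+ z :* (d :* b) := b :* (b :+ z :* d)) ≈-refl Z B D ⟩
    B ⊡ (B ⊞ Z ⊡ D)                   ≈⟨ *-cong (≈-sym hB) hC ⟩
    (A ⊞ Z ⊡ C) ⊡ C
      ≈⟨ solve 3 (λ z a c → (a :+ z :* c) :* c := c :* a :+ z :* (c :* c)) ≈-refl Z A C ⟩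
    C ⊡ A ⊞ Z ⊡ (C ⊡ C)               ≈⟨ +-congˡ (*-congˡ h) ⟩
    C ⊡ A ⊞ Z ⊡ (D ⊡ B ⊞ Y)
      ≈⟨ solve 6 (λ z y a b c d → c :* a :+ z :* (d :* b :+ y) := c :* a :+ z :* y :+ z :* (d :* b))
           ≈-refl Z Y A B C D ⟩
    C ⊡ A ⊞ Z ⊡ Y ⊞ Z ⊡ (D ⊡ B)       ∎)

PS-cancel : ∀ f g h → f ⊕ h ≐ g ⊕ h → f ≐ g
PS-cancel f g h p n = ∙-cancelʳ (h n) (f n) (g n) (p n)
  where open import Algebra.Properties.AbelianGroup ℤₚ.+-0-abelianGroup using (∙-cancelʳ)

⊕⇒⊖ : ∀ f g h → f ⊕ g ≐ h → f ≐ h ⊖ g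
⊕⇒⊖ f g h p n = ≡.trans
  (solve 2 (λ a b → a := (a :+ b) :- b) ≡.refl (f n) (g n)) (cong (λ t → t ℤ.- g n) (p n))
  where open ℤ-Solver

module PSLemmas = SemiringLemmas PS-commutativeSemiring PS-cancel
module PSR = CommutativeSemiring PS-commutativeSemiring
open SemiringSolver PS-commutativeSemiring using (solve; _:+_; _:*_; _:=_)
open SetoidReasoning PSR.setoid

-- Scaled Chebyshev polynomials and odd length

X : PS
X = xpow 1

xpow-2 : xpow 2 ≐ X ⊛ X
xpow-2 = PSR.sym (xpow-+ 1 1)

xpow-3 : xpow 3 ≐ X ⊛ X ⊛ X
xpow-3 = PSR.sym (PSR.trans (⊛-cong {g = X} (xpow-+ 1 1) (λ _ → ≡.refl)) (xpow-+ 2 1))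

xpow-cong : ∀ {a b} → a ≡ b → xpow a ≐ xpow b
xpow-cong ≡.refl _ = ≡.refl

W-cong : ∀ {a b} → a ≡ b → W a ≐ W b
W-cong ≡.refl _ = ≡.refl

W-rec : ∀ m → W (suc (suc m)) ⊕ xpow 2 ⊛ W m ≐ W (suc m)
W-rec m n = Z.solve 2 (λ a b → (a Z.:- b) Z.:+ b Z.:= a) ≡.refl (W (suc m) n) ((xpow 2 ⊛ W m) n)
  where module Z = ℤ-Solver

W-rec′ : ∀ m → W (suc (suc m)) ⊕ X ⊛ X ⊛ W m ≐ W (suc m)
W-rec′ m = PSR.trans (PSR.+-congˡ {x = W (suc (suc m))} (PSR.*-congʳ {x = W m} (PSR.sym xpow-2))) (W-rec m)

W-2 : W 2 ≐ xpow 0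
W-2 = PSR.trans (PSR.sym (PSR.+-identityʳ (W 2)))
  (PSR.trans (PSR.+-congˡ {x = W 2} (PSR.sym (PSR.zeroʳ (xpow 2)))) (W-rec 0))

cassini : ∀ m → W (suc m) ⊛ W (suc m) ≐ W m ⊛ W (suc (suc m)) ⊕ xpow (2 * m)
cassini zero = begin
  xpow 0 ⊛ xpow 0                  ≈⟨ PSR.*-identityˡ (xpow 0) ⟩
  xpow 0                           ≈⟨ PSR.+-identityˡ (xpow 0) ⟨
  zeroPS ⊕ xpow 0                  ≈⟨ PSR.+-congʳ {x = xpow 0} (PSR.zeroˡ (W 2)) ⟨
  zeroPS ⊛ W 2 ⊕ xpow 0            ∎
cassini (suc m) = begin
  W (suc (suc m)) ⊛ W (suc (suc m))
    ≈⟨ PSLemmas.cassini-step (xpow 2) (xpow (2 * m)) (W (3 + m)) (W (2 + m)) (W (1 + m)) (W m) (W-rec (suc m)) (W-rec m) (cassini m) ⟩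
  W (suc m) ⊛ W (suc (suc (suc m))) ⊕ xpow 2 ⊛ xpow (2 * m)
    ≈⟨ PSR.+-congˡ {x = W (suc m) ⊛ W (suc (suc (suc m)))} (PSR.trans (xpow-+ 2 (2 * m)) (xpow-cong (≡.sym (ℕₚ.*-suc 2 m)))) ⟩
  W (suc m) ⊛ W (suc (suc (suc m))) ⊕ xpow (2 * suc m) ∎

avoiders-odd : ∀ m → avoiders true m ⊛ W (suc (suc m)) ≐ X ⊛ W (suc m)
avoiders-odd zero    = PSR.*-cong avoiders-21 W-2
avoiders-odd (suc m) = PSLemmas.linear (avoiders true (suc m)) X X (avoiders true m) (W (3 + m)) (W (2 + m)) (W (1 + m))
  (avoiders-rec true m) (avoiders-odd m) (W-rec′ (suc m))

-- Unlike `avoiders-odd` this starts at k = 3. At k = 2 the word 1 2 avoids 2-1 too, and the series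
-- is 1 + x² instead of W_1/W_2 = 1.
avoiders-even : ∀ m → avoiders false (suc m) ⊛ W (suc (suc (suc m))) ≐ W (suc (suc m))
avoiders-even m = PSR.trans (PSLemmas.linear (avoiders false (suc m)) (xpow 0) X (avoiders true m) (W (3 + m)) (W (2 + m)) (W (1 + m))
  (avoiders-rec false m) (avoiders-odd m) (W-rec′ (suc m)))
  (PSR.*-identityˡ (W (suc (suc m))))

tail-avoiders-odd : ∀ m → X ⊛ tail (avoiders true m) ≐ avoiders true m
tail-avoiders-odd m zero    = xpow-suc-⊛-zero 0 (tail (avoiders true m))
tail-avoiders-odd m (suc n) = ≡.trans (xpow-suc-⊛-suc 0 (tail (avoiders true m)) n) (⊛-identityˡ (tail (avoiders true m)) n)

tail-avoiders-even : ∀ m → X ⊛ tail (avoiders false (suc m)) ⊕ xpow 0 ≐ avoiders false (suc m)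
tail-avoiders-even m zero    = cong (λ t → t ℤ.+ pos 1) (xpow-suc-⊛-zero 0 (tail (avoiders false (suc m))))
tail-avoiders-even m (suc n) = ≡.trans (ℤₚ.+-identityʳ _)
  (≡.trans (xpow-suc-⊛-suc 0 (tail (avoiders false (suc m))) n) (⊛-identityˡ (tail (avoiders false (suc m))) n))

containers-linear : ∀ q m → containers q (suc m) ⊛ W (3 + m) ≐ (X ⊛ (containers true m ⊛ avoiders q (suc m)) ⊕ crossTerm q (suc m)) ⊛ W (2 + m)
containers-linear q m = PSLemmas.linear (containers q (suc m))
  (X ⊛ (containers true m ⊛ avoiders q (suc m)) ⊕ crossTerm q (suc m)) X (avoiders true m)
  (W (3 + m)) (W (2 + m)) (W (1 + m)) (begin
  containers q (suc m)
    ≈⟨ containers-rec q m ⟩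
  X ⊛ (containers true m ⊛ avoiders q (suc m) ⊕ avoiders true m ⊛ containers q (suc m)) ⊕ crossTerm q (suc m)
    ≈⟨ solve 4 (λ x a b k → x :* (a :+ b) :+ k := (x :* a :+ k) :+ x :* b) PSR.refl
         X (containers true m ⊛ avoiders q (suc m)) (avoiders true m ⊛ containers q (suc m)) (crossTerm q (suc m)) ⟩
  (X ⊛ (containers true m ⊛ avoiders q (suc m)) ⊕ crossTerm q (suc m)) ⊕ X ⊛ (avoiders true m ⊛ containers q (suc m)) ∎)
  (avoiders-odd m) (W-rec′ (suc m))

oddSquared : ℕ → PS
oddSquared m = containers true m ⊛ W (2 + m) ⊛ W (2 + m)

oddSquared-0 : oddSquared 0 ≐ zeroPS
oddSquared-0 = PSR.trans (PSR.*-congʳ {x = W 2} (PSR.trans (PSR.*-congʳ {x = W 2} containers-21) (PSR.zeroˡ (W 2)))) (PSR.zeroˡ (W 2))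

containers-odd : ∀ m → oddSquared (suc m) ≐ X ⊛ X ⊛ oddSquared m ⊕ crossTerm true (suc m) ⊛ (W (3 + m) ⊛ W (2 + m))
containers-odd m = PSLemmas.quadratic (containers true (suc m)) X (containers true m) (avoiders true (suc m)) (crossTerm true (suc m))
  (W (3 + m)) (W (2 + m)) X (containers-linear true m) (avoiders-odd (suc m))

containers-even : ∀ m → containers false (suc m) ⊛ W (3 + m) ⊛ W (3 + m)
  ≐ (X ⊛ xpow 0) ⊛ oddSquared m ⊕ crossTerm false (suc m) ⊛ (W (3 + m) ⊛ W (2 + m))
containers-even m = PSLemmas.quadratic (containers false (suc m)) X (containers true m) (avoiders false (suc m)) (crossTerm false (suc m))
  (W (3 + m)) (W (2 + m)) (xpow 0) (containers-linear false m)
  (PSR.trans (avoiders-even m) (PSR.sym (PSR.*-identityˡ (W (2 + m)))))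

cross-X3 : ∀ q m → crossTerm q (2 + m) ≐ (X ⊛ X ⊛ X) ⊛ (avoiders false (suc m) ⊛ tail (avoiders q (2 + m)))
cross-X3 q m = PSR.trans (crossTerm-rec q m) (PSR.*-congʳ {x = avoiders false (suc m) ⊛ tail (avoiders q (2 + m))} xpow-3)

oddSquared-step : ∀ m → oddSquared (2 + m) ≐ xpow 2 ⊛ oddSquared (suc m) ⊕ xpow 3 ⊛ (W (3 + m) ⊛ W (2 + m))
oddSquared-step m = begin
  oddSquared (2 + m)
    ≈⟨ containers-odd (suc m) ⟩
  X ⊛ X ⊛ oddSquared (suc m) ⊕ crossTerm true (2 + m) ⊛ (W (4 + m) ⊛ W (3 + m))
    ≈⟨ PSR.+-cong (PSR.*-congʳ {x = oddSquared (suc m)} (PSR.sym xpow-2))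
         (PSR.trans (PSLemmas.cross-odd (crossTerm true (2 + m)) X (avoiders false (suc m)) (tail (avoiders true (2 + m))) (avoiders true (2 + m))
           (W (4 + m)) (W (3 + m)) (W (2 + m))
           (cross-X3 true m) (tail-avoiders-odd (2 + m)) (avoiders-even m) (avoiders-odd (2 + m)))
           (PSR.*-congʳ {x = W (3 + m) ⊛ W (2 + m)} (PSR.sym xpow-3))) ⟩
  xpow 2 ⊛ oddSquared (suc m) ⊕ xpow 3 ⊛ (W (3 + m) ⊛ W (2 + m)) ∎

-- The general step would contribute x³W_2W_1, but the word 1 3 2 contributes x³W_3W_2 with W_3 =
-- W_2 - x². The difference x^5 is the origin of the subtracted x in (1).
oddSquared-1 : oddSquared 1 ⊕ xpow 5 ≐ xpow 3 ⊛ (W 2 ⊛ W 1)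
oddSquared-1 = begin
  oddSquared 1 ⊕ xpow 5
    ≈⟨ PSR.+-cong (containers-odd 0) (PSR.sym (xpow-+ 3 2)) ⟩
  X ⊛ X ⊛ oddSquared 0 ⊕ crossTerm true 1 ⊛ (W 3 ⊛ W 2) ⊕ xpow 3 ⊛ xpow 2
    ≈⟨ PSR.+-congʳ {x = xpow 3 ⊛ xpow 2} (PSR.+-cong (PSR.trans (PSR.*-congˡ {x = X ⊛ X} oddSquared-0) (PSR.zeroʳ (X ⊛ X)))
         (PSR.*-cong crossTerm-213 (PSR.*-congˡ {x = W 3} W-2))) ⟩
  zeroPS ⊕ xpow 3 ⊛ (W 3 ⊛ xpow 0) ⊕ xpow 3 ⊛ xpow 2
    ≈⟨ PSR.+-cong (PSR.trans (PSR.+-identityˡ (xpow 3 ⊛ (W 3 ⊛ xpow 0))) (PSR.*-congˡ {x = xpow 3} (PSR.*-identityʳ (W 3))))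
         (PSR.*-congˡ {x = xpow 3} (PSR.sym (PSR.*-identityʳ (xpow 2)))) ⟩
  xpow 3 ⊛ W 3 ⊕ xpow 3 ⊛ (xpow 2 ⊛ W 1)
    ≈⟨ PSR.distribˡ (xpow 3) (W 3) (xpow 2 ⊛ W 1) ⟨
  xpow 3 ⊛ (W 3 ⊕ xpow 2 ⊛ W 1)
    ≈⟨ PSR.*-congˡ {x = xpow 3} (PSR.trans (W-rec 1) (PSR.sym (PSR.*-identityʳ (W 2)))) ⟩
  xpow 3 ⊛ (W 2 ⊛ W 1) ∎

sumPS-cong : ∀ m {f g : ℕ → PS} → (∀ j → j < m → f j ≐ g j) → sumPS m f ≐ sumPS m g
sumPS-cong zero    h n = ≡.refl
sumPS-cong (suc m) h n = cong₂ ℤ._+_ (sumPS-cong m (λ j j<m → h j (ℕₚ.m≤n⇒m≤1+n j<m)) n) (h m ℕₚ.≤-refl n)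

sumPS-⊛ : ∀ m c (f : ℕ → PS) → sumPS m (λ j → c ⊛ f j) ≐ c ⊛ sumPS m f
sumPS-⊛ zero    c f = PSR.sym (PSR.zeroʳ c)
sumPS-⊛ (suc m) c f = PSR.trans (PSR.+-congʳ {x = c ⊛ f m} (sumPS-⊛ m c f)) (PSR.sym (PSR.distribˡ c (sumPS m f) (f m)))

-- For k = p + 3 this is x^(2k-2) U_{j+1}U_j in terms of the scaled polynomials.
summand : ℕ → ℕ → PS
summand p j = xpow (2 * (3 + p) ∸ 3 ∸ 2 * j) ⊛ (W (j + 2) ⊛ W (j + 1))

-- The bound on `j` keeps the truncated subtraction from reaching 0 too early.
exponent-step : ∀ p j → j ≤ p → 2 * (4 + p) ∸ 3 ∸ 2 * j ≡ 2 + (2 * (3 + p) ∸ 3 ∸ 2 * j)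
exponent-step p j j≤p = ≡.trans (cong (λ t → t ∸ 3 ∸ 2 * j) (ℕₚ.*-distribˡ-+ 2 4 p))
  (≡.trans (ℕₚ.+-∸-assoc 2 (ℕₚ.≤-trans (ℕₚ.*-monoʳ-≤ 2 j≤p) (ℕₚ.m≤n+m (2 * p) 3)))
    (cong (λ t → 2 + (t ∸ 3 ∸ 2 * j)) (≡.sym (ℕₚ.*-distribˡ-+ 2 3 p))))

exponent-last : ∀ p → 2 * (4 + p) ∸ 3 ∸ 2 * suc p ≡ 3
exponent-last p = ≡.trans (cong₂ (λ s t → s ∸ 3 ∸ t) (ℕₚ.*-distribˡ-+ 2 4 p) (ℕₚ.*-distribˡ-+ 2 1 p))
  (ℕₚ.m+n∸n≡m 3 (2 * p))

exponent-top : ∀ p → 2 * (4 + p) ∸ 1 ≡ 2 + (2 * (3 + p) ∸ 1)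
exponent-top p = ≡.trans (cong (_∸ 1) (ℕₚ.*-distribˡ-+ 2 4 p))
  (cong (λ t → 2 + (t ∸ 1)) (≡.sym (ℕₚ.*-distribˡ-+ 2 3 p)))

sum-step : ∀ p → sumPS (suc p) (summand (suc p)) ≐ xpow 2 ⊛ sumPS (suc p) (summand p)
sum-step p = PSR.trans (sumPS-cong (suc p) λ { j (s≤s j≤p) → PSR.trans
    (PSR.*-congʳ {x = W (j + 2) ⊛ W (j + 1)} (PSR.trans (xpow-cong (exponent-step p j j≤p))
      (PSR.sym (xpow-+ 2 (2 * (3 + p) ∸ 3 ∸ 2 * j)))))
    (PSR.*-assoc (xpow 2) (xpow (2 * (3 + p) ∸ 3 ∸ 2 * j)) (W (j + 2) ⊛ W (j + 1))) })
  (sumPS-⊛ (suc p) (xpow 2) (summand p))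

-- Passing from k to k + 1 multiplies every term, x^(2k-1) included, by x² and appends x³W_kW_{k-1}
-- as the new last summand.
oddSquared-sum : ∀ p → oddSquared (suc p) ⊕ xpow (2 * (3 + p) ∸ 1) ≐ sumPS (suc p) (summand p)
oddSquared-sum zero    = PSR.trans oddSquared-1 (PSR.sym (PSR.+-identityˡ (xpow 3 ⊛ (W 2 ⊛ W 1))))
oddSquared-sum (suc p) = begin
  oddSquared (2 + p) ⊕ xpow (2 * (4 + p) ∸ 1)
    ≈⟨ PSR.+-cong (oddSquared-step p) (PSR.trans (xpow-cong (exponent-top p)) (PSR.sym (xpow-+ 2 (2 * (3 + p) ∸ 1)))) ⟩
  (xpow 2 ⊛ oddSquared (suc p) ⊕ xpow 3 ⊛ (W (3 + p) ⊛ W (2 + p))) ⊕ xpow 2 ⊛ xpow (2 * (3 + p) ∸ 1)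
    ≈⟨ solve 4 (λ x a b y → (x :* a :+ b) :+ x :* y := x :* (a :+ y) :+ b) PSR.refl
         (xpow 2) (oddSquared (suc p)) (xpow 3 ⊛ (W (3 + p) ⊛ W (2 + p))) (xpow (2 * (3 + p) ∸ 1)) ⟩
  xpow 2 ⊛ (oddSquared (suc p) ⊕ xpow (2 * (3 + p) ∸ 1)) ⊕ xpow 3 ⊛ (W (3 + p) ⊛ W (2 + p))
    ≈⟨ PSR.+-cong (PSR.*-congˡ {x = xpow 2} (oddSquared-sum p))
         (PSR.*-cong (xpow-cong (≡.sym (exponent-last p)))
           (PSR.*-cong (W-cong (ℕₚ.+-comm 2 (suc p))) (W-cong (ℕₚ.+-comm 1 (suc p))))) ⟩
  xpow 2 ⊛ sumPS (suc p) (summand p) ⊕ summand (suc p) (suc p)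
    ≈⟨ PSR.+-congʳ {x = summand (suc p) (suc p)} (sum-step p) ⟨
  sumPS (suc p) (summand (suc p)) ⊕ summand (suc p) (suc p) ∎

-- Even length and conclusion

evenSquared : ℕ → PS
evenSquared m = X ⊛ (containers false m ⊛ W (2 + m) ⊛ W (2 + m))

-- Both sources dry up at k = 3: no odd alternating word avoids 2-1 and contains 1-3-2, and the only
-- crossing word 1 3 2 has odd length.
evenSquared-1 : evenSquared 1 ≐ zeroPS
evenSquared-1 = begin
  X ⊛ (containers false 1 ⊛ W 3 ⊛ W 3)
    ≈⟨ PSR.*-congˡ {x = X} (containers-even 0) ⟩
  X ⊛ ((X ⊛ xpow 0) ⊛ oddSquared 0 ⊕ crossTerm false 1 ⊛ (W 3 ⊛ W 2))
    ≈⟨ PSR.*-congˡ {x = X} (PSR.+-cong (PSR.trans (PSR.*-congˡ {x = X ⊛ xpow 0} oddSquared-0) (PSR.zeroʳ (X ⊛ xpow 0)))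
         (PSR.trans (PSR.*-congʳ {x = W 3 ⊛ W 2} crossTerm-213-even) (PSR.zeroˡ (W 3 ⊛ W 2)))) ⟩
  X ⊛ (zeroPS ⊕ zeroPS)
    ≈⟨ PSR.*-congˡ {x = X} (PSR.+-identityˡ zeroPS) ⟩
  X ⊛ zeroPS
    ≈⟨ PSR.zeroʳ X ⟩
  zeroPS ∎

-- For k = p + 4 the cross term is x^5W_{k-2}², which `cassini` splits into x^5W_{k-3}W_{k-1} and
-- x^(2k-1). The latter is x² times the power that `oddSquared-sum` requires beside
-- ud_{k-1}W_{k-1}².
evenSquared-sum : ∀ p → evenSquared (2 + p) ≐ xpow 5 ⊛ (W (suc p) ⊛ W (3 + p)) ⊕ sumPS (suc p) (summand (suc p))
evenSquared-sum p = begin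
  X ⊛ (containers false (2 + p) ⊛ W (4 + p) ⊛ W (4 + p))
    ≈⟨ PSR.*-congˡ {x = X} (containers-even (suc p)) ⟩
  X ⊛ ((X ⊛ xpow 0) ⊛ Po ⊕ K ⊛ (W (4 + p) ⊛ W (3 + p)))
    ≈⟨ PSR.distribˡ X ((X ⊛ xpow 0) ⊛ Po) (K ⊛ (W (4 + p) ⊛ W (3 + p))) ⟩
  X ⊛ ((X ⊛ xpow 0) ⊛ Po) ⊕ X ⊛ (K ⊛ (W (4 + p) ⊛ W (3 + p)))
    ≈⟨ PSR.+-cong
         (PSR.trans (PSR.*-congˡ {x = X} (PSR.*-congʳ {x = Po} (PSR.*-identityʳ X)))
           (PSR.trans (PSR.sym (PSR.*-assoc X X Po)) (PSR.*-congʳ {x = Po} (xpow-+ 1 1))))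
         (PSR.trans (PSLemmas.cross-even K X (avoiders false (suc p)) (tail (avoiders false (2 + p))) (avoiders false (2 + p))
           (W (4 + p)) (W (3 + p)) (W (2 + p))
           (cross-X3 false p) (tail-avoiders-even (suc p)) (avoiders-even p) (avoiders-even (suc p)) (W-rec′ (2 + p)))
           (PSR.*-congʳ {x = W (2 + p) ⊛ W (2 + p)} (PSR.trans (PSR.*-cong (PSR.sym xpow-2) (PSR.sym xpow-3)) (xpow-+ 2 3)))) ⟩
  xpow 2 ⊛ Po ⊕ xpow 5 ⊛ (W (2 + p) ⊛ W (2 + p))
    ≈⟨ PSR.+-congˡ {x = xpow 2 ⊛ Po} (PSR.*-congˡ {x = xpow 5} (cassini (suc p))) ⟩
  xpow 2 ⊛ Po ⊕ xpow 5 ⊛ (W (suc p) ⊛ W (3 + p) ⊕ xpow (2 * suc p))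
    ≈⟨ PSR.+-congˡ {x = xpow 2 ⊛ Po} (PSR.trans (PSR.distribˡ (xpow 5) (W (suc p) ⊛ W (3 + p)) (xpow (2 * suc p)))
         (PSR.+-congˡ {x = xpow 5 ⊛ (W (suc p) ⊛ W (3 + p))} (PSR.trans (xpow-+ 5 (2 * suc p))
           (PSR.trans (xpow-cong exponent) (PSR.sym (xpow-+ 2 (2 * (3 + p) ∸ 1))))))) ⟩
  xpow 2 ⊛ Po ⊕ (xpow 5 ⊛ (W (suc p) ⊛ W (3 + p)) ⊕ xpow 2 ⊛ xpow (2 * (3 + p) ∸ 1))
    ≈⟨ solve 4 (λ x a b y → x :* a :+ (b :+ x :* y) := b :+ x :* (a :+ y)) PSR.refl
         (xpow 2) Po (xpow 5 ⊛ (W (suc p) ⊛ W (3 + p))) (xpow (2 * (3 + p) ∸ 1)) ⟩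
  xpow 5 ⊛ (W (suc p) ⊛ W (3 + p)) ⊕ xpow 2 ⊛ (Po ⊕ xpow (2 * (3 + p) ∸ 1))
    ≈⟨ PSR.+-congˡ {x = xpow 5 ⊛ (W (suc p) ⊛ W (3 + p))} (PSR.trans (PSR.*-congˡ {x = xpow 2} (oddSquared-sum p)) (PSR.sym (sum-step p))) ⟩
  xpow 5 ⊛ (W (suc p) ⊛ W (3 + p)) ⊕ sumPS (suc p) (summand (suc p)) ∎
  where
  Po = oddSquared (suc p)
  K  = crossTerm false (2 + p)
  exponent : 5 + 2 * suc p ≡ 2 + (2 * (3 + p) ∸ 1)
  exponent = ≡.trans (cong (5 +_) (ℕₚ.*-distribˡ-+ 2 1 p)) (cong (λ t → 2 + (t ∸ 1)) (≡.sym (ℕₚ.*-distribˡ-+ 2 3 p)))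

-- As W_k has constant term 1 it is invertible, so the equations multiplied by W_k² determine the
-- same series as the quotients.
theorem4p7 : (k : ℕ) → 3 ≤ k →
    ((n : ℕ) → (UD k ⊛ W k ⊛ W k) n
    ≡ (sumPS (k ∸ 2) (λ j → xpow (2 * k ∸ 3 ∸ 2 * j) ⊛ (W (j + 2) ⊛ W (j + 1)))
    ⊖ xpow (2 * k ∸ 1)) n)
    × ((n : ℕ) → (xpow 1 ⊛ UU k ⊛ W k ⊛ W k) n
    ≡ (xpow 5 ⊛ (W (k ∸ 3) ⊛ W (k ∸ 1))
    ⊕ sumPS (k ∸ 3) (λ j → xpow (2 * k ∸ 3 ∸ 2 * j) ⊛ (W (j + 1) ⊛ W (j + 2)))) n)
theorem4p7 (suc (suc (suc p))) (s≤s (s≤s (s≤s z≤n))) =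
  PSR.trans (PSR.*-congʳ {x = W (3 + p)} (PSR.*-congʳ {x = W (3 + p)} (UD≐containers (suc p))))
    (⊕⇒⊖ (oddSquared (suc p)) (xpow (2 * (3 + p) ∸ 1)) (sumPS (suc p) (summand p)) (oddSquared-sum p)) ,
  PSR.trans (PSR.*-congʳ {x = W (3 + p)} (PSR.*-congʳ {x = W (3 + p)} (PSR.*-congˡ {x = X} (UU≐containers (suc p)))))
    (PSR.trans (solve 3 (λ x t w → x :* t :* w :* w := x :* (t :* w :* w)) PSR.refl X (containers false (suc p)) (W (3 + p)))
      (even p))
  where
  even : ∀ p → evenSquared (suc p) ≐ xpow 5 ⊛ (W p ⊛ W (2 + p))
    ⊕ sumPS p (λ j → xpow (2 * (3 + p) ∸ 3 ∸ 2 * j) ⊛ (W (j + 1) ⊛ W (j + 2)))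
  even zero    = PSR.trans evenSquared-1 (PSR.sym (PSR.trans (PSR.+-identityʳ (xpow 5 ⊛ (W 0 ⊛ W 2)))
    (PSR.trans (PSR.*-congˡ {x = xpow 5} (PSR.zeroˡ (W 2))) (PSR.zeroʳ (xpow 5)))))
  even (suc p) = PSR.trans (evenSquared-sum p) (PSR.+-congˡ {x = xpow 5 ⊛ (W (suc p) ⊛ W (3 + p))}
    (sumPS-cong (suc p) λ j _ → PSR.*-congˡ {x = xpow (2 * (4 + p) ∸ 3 ∸ 2 * j)} (PSR.*-comm (W (j + 2)) (W (j + 1)))))
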